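{- Connected Vertex Cover parameterized by the size $k$ of a clique deletion set has a time efficient PSAKS in which, for every $\alpha>1$, the output graph of the $\alpha$-approximate kernel has at most $k + \left\lceil \frac{2\alpha-1}{\alpha-1} \right\rceil$ vertices.
   Context: All graphs are finite, simple and undirected. A connected vertex cover of $G$ is a set $T\subseteq V(G)$ containing an endpoint of every edge such that $G[T]$ is connected. A clique deletion set of $G$ is a set $S\subseteq V(G)$ such that $G-S$ is a complete graph. Parameterized minimization problem considered: instances are $((G,S),k)$ with $G$ a graph, $S\subseteq V(G)$, $k\in\mathbb{N}$; a solution is a set $T\subseteq V(G)$ and its value $CVC((G,S),k,T)$ is (first applicable case) $-\infty$ if $|S|>k$ or $G-S$ is not a complete graph; $\infty$ if $T$ is not a connected vertex cover of $G$; $|T|$ otherwise. Lossy kernelization: for a parameterized minimization problem $\Pi$, with value $\Pi(I,k,T)$ of a solution $T$ of instance $(I,k)$, let $\mathrm{OPT}(I,k)$ be the minimum value over solutions. For $\alpha\ge 1$, an $\alpha$-approximate kernel is a pair of polynomial-time algorithms: a reduction algorithm mapping $(I,k)$ to an instance $(I',k')$ of $\Pi$ whose size is bounded by a computable function of $k$, and a solution lifting algorithm which, given $(I,k)$, $(I',k')$ and a solution $T'$ of $(I',k')$, computes a solution $T$ of $(I,k)$ with $\frac{\Pi(I,k,T)}{\mathrm{OPT}(I,k)}\le \alpha\cdot\frac{\Pi(I',k',T')}{\mathrm{OPT}(I',k')}$ (i.e. a $c$-approximate solution of the reduced instance is turned into an $\alpha c$-approximate solution of the original, for every $c\ge1$).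 A polynomial-size approximate kernelization scheme (PSAKS) is a family of $\alpha$-approximate kernels, one for each $\alpha>1$, whose output size is at most $f(\alpha)k^{g(\alpha)}$ for some functions $f,g$ independent of $|I|$ and $k$. It is time efficient if both algorithms run in time $f(\alpha)|I|^{c}$ for some computable $f$ and a constant $c$.
   Formalization: The approximation ratio α (and the factor c in the definition of an α-approximate kernel) ranges over rational numbers instead of real numbers; the claim for real α follows from the rational ratio 1 + 1/⌈1/(α−1)⌉, which is at most α and gives the same vertex bound. -}

module Defs where

open import Data.Bool.Base using (Bool; true; false; T; not; _∨_; if_then_else_)
open import Data.Bool.Properties using (T?)
open import Data.Fin.Base using (Fin; zero; suc)
open import Data.Fin.Properties using (_≟_; all?)
open import Data.Fin.Subset using (Subset; _∈_; _∉_; ∣_∣)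
open import Data.Fin.Subset.Properties using (_∈?_)
open import Data.Integer.Base using (ℤ; +_; -[1+_])
open import Data.List.Base using (List; []; _∷_; foldr; allFin)
open import Data.List.Membership.Propositional using () renaming (_∈_ to _∈ᴸ_)
open import Data.List.Membership.Propositional.Properties using (∈-allFin)
open import Data.List.Relation.Unary.Any using (here; there)
open import Data.Nat.Base using (ℕ; zero; suc; _+_; _*_; _^_; _≤_; _⊔_)
open import Data.Nat.Properties using (_<?_)
open import Data.Product.Base using (Σ; ∃; ∃₂; _×_; _,_; proj₁; proj₂; uncurry)
open import Data.Rational.Base as ℚ using (ℚ; mkℚ; 1ℚ; _/_)
open import Data.Rational.Properties using (+-monoˡ-<; +-inverseʳ)
open import Data.Sum.Base using (_⊎_; inj₁; inj₂)
open import Data.Vec.Base using (Vec; []; _∷_; lookup; tabulate; toList; replicate; head; _[_]≔_)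
open import Level using (0ℓ)
open import Relation.Binary.Construct.Closure.ReflexiveTransitive using (Star; ε; _◅_; _◅◅_)
import Relation.Binary.Construct.Add.Extrema.NonStrict as AddExtrema
open import Relation.Binary.Core using (Rel)
open import Relation.Binary.Definitions using (Decidable)
open import Relation.Binary.PropositionalEquality using (_≡_; _≢_; refl; subst)
open import Relation.Nullary using (Dec; does; ¬?)
open import Relation.Nullary.Construct.Add.Extrema using (_±; ⊥±; ⊤±; [_])
open import Relation.Nullary.Decidable using (map′; _×-dec_; _⊎-dec_; _→-dec_)

------------------------------------------------------------------------
-- Model of computation: the language WHILE of N. D. Jones, "Computability
-- and Complexity", with its unit-cost time measure.  It is Turing complete
-- and, with the time of Runs below, its polynomial-time computable functions
-- are those of Turing machines.

infixr 5 _∙_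

data 𝔻 : Set where
  nil : 𝔻
  _∙_ : 𝔻 → 𝔻 → 𝔻

size : 𝔻 → ℕ
size nil     = 1
size (d ∙ e) = suc (size d + size e)

data Exp (n : ℕ) : Set where
  var   : Fin n → Exp n
  quot  : 𝔻 → Exp n
  cons  : Exp n → Exp n → Exp n
  hd tl : Exp n → Exp n

Store : ℕ → Set
Store n = Vec 𝔻 n

hd𝔻 tl𝔻 : 𝔻 → 𝔻
hd𝔻 nil     = nil
hd𝔻 (d ∙ _) = d
tl𝔻 nil     = nil
tl𝔻 (_ ∙ e) = e

eval : ∀ {n} → Exp n → Store n → 𝔻
eval (var x)    σ = lookup σ x
eval (quot d)   σ = d
eval (cons a b) σ = eval a σ ∙ eval b σ
eval (hd a)     σ = hd𝔻 (eval a σ)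
eval (tl a)     σ = tl𝔻 (eval a σ)

cost : ∀ {n} → Exp n → ℕ
cost (var _)    = 1
cost (quot _)   = 1
cost (cons a b) = suc (cost a + cost b)
cost (hd a)     = suc (cost a)
cost (tl a)     = suc (cost a)

infix  7 _≔_
infixr 6 _⨾_

-- cond a p q is "if a then p else q" and loop a p is "while a do p".
data Cmd (n : ℕ) : Set where
  _≔_  : Fin n → Exp n → Cmd n
  _⨾_  : Cmd n → Cmd n → Cmd n
  cond : Exp n → Cmd n → Cmd n → Cmd n
  loop : Exp n → Cmd n → Cmd n

-- p , σ ⇓ σ′ within t : from store σ, p terminates in store σ′ after
-- exactly t steps.  nil is the only false value.
infix 4 _,_⇓_within_

data _,_⇓_within_ {n : ℕ} : Cmd n → Store n → Store n → ℕ → Set where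
  assign : ∀ {x a σ} →
    x ≔ a , σ ⇓ σ [ x ]≔ eval a σ within suc (cost a)
  seq : ∀ {p q σ σ′ σ″ s t} →
    p , σ ⇓ σ′ within s → q , σ′ ⇓ σ″ within t →
    p ⨾ q , σ ⇓ σ″ within s + t
  if-true : ∀ {a p q σ σ′ t} → eval a σ ≢ nil →
    p , σ ⇓ σ′ within t →
    cond a p q , σ ⇓ σ′ within suc (cost a + t)
  if-false : ∀ {a p q σ σ′ t} → eval a σ ≡ nil →
    q , σ ⇓ σ′ within t →
    cond a p q , σ ⇓ σ′ within suc (cost a + t)
  while-true : ∀ {a p σ σ′ σ″ s t} → eval a σ ≢ nil →
    p , σ ⇓ σ′ within s → loop a p , σ′ ⇓ σ″ within t →
    loop a p , σ ⇓ σ″ within suc (cost a + (s + t))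
  while-false : ∀ {a p σ} → eval a σ ≡ nil →
    loop a p , σ ⇓ σ within suc (cost a)

-- Variable zero holds the input at the start and the output at the end.
record Program : Set where
  constructor program
  field
    {locals} : ℕ
    body     : Cmd (suc locals)

-- The time t includes writing out the output: since subtrees are shared, s
-- steps can produce trees of size exponential in s.
Runs : Program → 𝔻 → 𝔻 → ℕ → Set
Runs (program body) input output t =
  ∃₂ λ σ s → (body , (input ∷ replicate _ nil) ⇓ σ within s) ×
             head σ ≡ output × s + size output ≡ t

Computable : {A B : Set} → (A → 𝔻) → (B → 𝔻) → (A → B) → Set
Computable ⌜_⌝ᴬ ⌜_⌝ᴮ f = ∃ λ p → ∀ x → ∃ λ t → Runs p ⌜ x ⌝ᴬ ⌜ f x ⌝ᴮ t

------------------------------------------------------------------------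
-- Encodings

encodeList : {A : Set} → (A → 𝔻) → List A → 𝔻
encodeList ⌜_⌝ = foldr (λ x d → ⌜ x ⌝ ∙ d) nil

encodeBool : Bool → 𝔻
encodeBool false = nil
encodeBool true  = nil ∙ nil

encodeℕ : ℕ → 𝔻
encodeℕ zero    = nil
encodeℕ (suc n) = nil ∙ encodeℕ n

encodeℤ : ℤ → 𝔻
encodeℤ (+ n)    = nil ∙ encodeℕ n
encodeℤ -[1+ n ] = (nil ∙ nil) ∙ encodeℕ n

encodeℚ : ℚ → 𝔻
encodeℚ (mkℚ p q-1 _) = encodeℤ p ∙ encodeℕ (suc q-1)

encodeSubset : ∀ {n} → Subset n → 𝔻
encodeSubset S = encodeList encodeBool (toList S)

------------------------------------------------------------------------
-- Parameterized minimization problems; ⊥± and ⊤± are -∞ and ∞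

open AddExtrema _≤_ public using () renaming (_≤±_ to _≤ℕ±_)
open AddExtrema ℚ._≤_ public using () renaming (_≤±_ to _≤ℚ±_)

record Problem : Set₁ where
  field
    Instance       : Set
    Solution       : Instance → Set
    value          : ∀ I → ℕ → Solution I → ℕ ±
    encodeInstance : Instance → 𝔻
    encodeSolution : ∀ {I} → Solution I → 𝔻

  encode : Instance → ℕ → 𝔻
  encode I k = encodeInstance I ∙ encodeℕ k

  IsOPT : Instance → ℕ → ℕ ± → Set
  IsOPT I k o = (∃ λ T → value I k T ≡ o) × (∀ T → o ≤ℕ± value I k T)

fromℕ± : ℕ ± → ℚ ±
fromℕ± ⊥±    = ⊥±
fromℕ± [ n ] = [ + n / 1 ]
fromℕ± ⊤±    = ⊤±

-- Only used for positive c.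
scale : ℚ → ℕ ± → ℚ ±
scale c ⊥±    = ⊥±
scale c [ n ] = [ c ℚ.* (+ n / 1) ]
scale c ⊤±    = ⊤±

-- value / OPT ≤ c, stated without dividing, as OPT may be 0 or infinite.
IsApprox : (Π : Problem) → ℚ → ∀ I → ℕ → Problem.Solution Π I → Set
IsApprox Π c I k T =
  ∃ λ o → IsOPT I k o × fromℕ± (value I k T) ≤ℚ± scale c o
  where
  open Problem Π

------------------------------------------------------------------------
-- Approximate kernels

record ApproxKernel (Π : Problem) (α : ℚ) : Set where
  open Problem Π
  field
    reduceProgram : Program
    reduced       : Instance → ℕ → Instance × ℕ
    reduceTime    : Instance → ℕ → ℕ
    reduce-runs   : ∀ I k →
      Runs reduceProgram (encode I k) (uncurry encode (reduced I k)) (reduceTime I k)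

  reducedInstance : Instance → ℕ → Instance
  reducedInstance I k = proj₁ (reduced I k)

  reducedParameter : Instance → ℕ → ℕ
  reducedParameter I k = proj₂ (reduced I k)

  outputSize : Instance → ℕ → ℕ
  outputSize I k = size (uncurry encode (reduced I k))

  liftInput : ∀ I k → Solution (reducedInstance I k) → 𝔻
  liftInput I k T′ = encode I k ∙ uncurry encode (reduced I k) ∙ encodeSolution T′

  field
    liftProgram : Program
    lifted      : ∀ I k → Solution (reducedInstance I k) → Solution I
    liftTime    : ∀ I k → Solution (reducedInstance I k) → ℕ
    lift-runs   : ∀ I k T′ →
      Runs liftProgram (liftInput I k T′) (encodeSolution (lifted I k T′)) (liftTime I k T′)

    reduce-polynomial : ∃₂ λ a c → ∀ I k →
      reduceTime I k ≤ a * size (encode I k) ^ c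
    lift-polynomial   : ∃₂ λ a c → ∀ I k T′ →
      liftTime I k T′ ≤ a * size (liftInput I k T′) ^ c

    sizeBound            : ℕ → ℕ
    sizeBound-computable : Computable encodeℕ encodeℕ sizeBound
    outputSize-bounded   : ∀ I k → outputSize I k ≤ sizeBound k

    lift-approx : ∀ c → 1ℚ ℚ.≤ c → ∀ I k T′ →
      IsApprox Π c (reducedInstance I k) (reducedParameter I k) T′ →
      IsApprox Π (α ℚ.* c) I k (lifted I k T′)

-- The ratio α is rational, so that functions of α can be required to be
-- computable.
record PSAKS (Π : Problem) : Set where
  open Problem Π
  open ApproxKernel
  field
    kernel : ∀ α → 1ℚ ℚ.< α → ApproxKernel Π α
    f g    : ℚ → ℕ
    -- k ⊔ 1 because no encoding has size 0, so f α * k ^ g α bounds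
    -- no size for k = 0 unless g α = 0.
    outputSize-polynomial : ∀ α (1<α : 1ℚ ℚ.< α) I k →
      outputSize (kernel α 1<α) I k ≤ f α * (k ⊔ 1) ^ g α

IsTimeEfficient : {Π : Problem} → PSAKS Π → Set
IsTimeEfficient {Π} P =
  Σ (ℚ → ℕ) λ f → Computable encodeℚ encodeℕ f × ∃ λ c →
  ∀ α (1<α : 1ℚ ℚ.< α) I k →
    reduceTime (kernel α 1<α) I k ≤ f α * size (encodeInstance I) ^ c ×
    (∀ T′ → liftTime (kernel α 1<α) I k T′ ≤ f α * size (encodeInstance I) ^ c)
  where
  open Problem Π
  open ApproxKernel
  open PSAKS P using (kernel)

------------------------------------------------------------------------
-- Graphs

record Graph : Set where
  field
    order      : ℕ
    adj        : Fin order → Fin order → Bool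
    adj-sym    : ∀ u v → adj u v ≡ adj v u
    adj-irrefl : ∀ v → adj v v ≡ false

  infix 4 _~_ _~?_

  _~_ : Rel (Fin order) 0ℓ
  u ~ v = T (adj u v)

  _~?_ : Decidable _~_
  u ~? v = T? (adj u v)

encodeGraph : Graph → 𝔻
encodeGraph G = encodeList (encodeList encodeBool) rows
  where
  open Graph G
  rows = toList (tabulate λ u → toList (tabulate (adj u)))

module _ (G : Graph) where
  open Graph G

  CompleteOutside : Subset order → Set
  CompleteOutside S = ∀ u v → u ∉ S → v ∉ S → u ≢ v → u ~ v

  Covers : Subset order → Set
  Covers T = ∀ u v → u ~ v → u ∈ T ⊎ v ∈ T

  InducedEdge : Subset order → Rel (Fin order) 0ℓ
  InducedEdge T u v = u ∈ T × v ∈ T × u ~ v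

  -- In particular the graph without vertices is connected.
  Connected : Subset order → Set
  Connected T = ∀ u v → u ∈ T → v ∈ T → Star (InducedEdge T) u v

  IsConnectedVertexCover : Subset order → Set
  IsConnectedVertexCover T = Covers T × Connected T

------------------------------------------------------------------------
-- Decidability of the above

-- Warshall's algorithm: Path ws u v says that there is a walk from u to v
-- all of whose inner vertices are in ws.
module Reachability {A : Set} (_≟ᴬ_ : Decidable {A = A} _≡_)
                    {R : Rel A 0ℓ} (R? : Decidable R) where

  Path : List A → Rel A 0ℓ
  Path []       u v = u ≡ v ⊎ R u v
  Path (w ∷ ws) u v = Path ws u v ⊎ (Path ws u w × Path ws w v)

  path? : ∀ ws → Decidable (Path ws)
  path? []       u v = (u ≟ᴬ v) ⊎-dec R? u v
  path? (w ∷ ws) u v = path? ws u v ⊎-dec (path? ws u w ×-dec path? ws w v)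

  toStar : ∀ ws {u v} → Path ws u v → Star R u v
  toStar []       (inj₁ refl)    = ε
  toStar []       (inj₂ r)       = r ◅ ε
  toStar (w ∷ ws) (inj₁ p)       = toStar ws p
  toStar (w ∷ ws) (inj₂ (p , q)) = toStar ws p ◅◅ toStar ws q

  reflPath : ∀ ws {u} → Path ws u u
  reflPath []       = inj₁ refl
  reflPath (w ∷ ws) = inj₁ (reflPath ws)

  edgePath : ∀ ws {u v} → R u v → Path ws u v
  edgePath []       r = inj₂ r
  edgePath (w ∷ ws) r = inj₁ (edgePath ws r)

  join : ∀ ws {u x v} → x ∈ᴸ ws → Path ws u x → Path ws x v → Path ws u v
  join (w ∷ ws) (here refl) p q = inj₂ (upTo p , from q)
    where
    upTo : ∀ {u} → Path (w ∷ ws) u w → Path ws u w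
    upTo (inj₁ p)       = p
    upTo (inj₂ (p , _)) = p
    from : ∀ {v} → Path (w ∷ ws) w v → Path ws w v
    from (inj₁ p)       = p
    from (inj₂ (_ , q)) = q
  join (w ∷ ws) (there i) (inj₁ p)       (inj₁ q)       = inj₁ (join ws i p q)
  join (w ∷ ws) (there i) (inj₁ p)       (inj₂ (q , r)) = inj₂ (join ws i p q , r)
  join (w ∷ ws) (there i) (inj₂ (p , q)) (inj₁ r)       = inj₂ (p , join ws i q r)
  join (w ∷ ws) (there i) (inj₂ (p , _)) (inj₂ (_ , r)) = inj₂ (p , r)

  fromStar : ∀ ws → (∀ x → x ∈ᴸ ws) → ∀ {u v} → Star R u v → Path ws u v
  fromStar ws all ε        = reflPath ws
  fromStar ws all (r ◅ rs) = join ws (all _) (edgePath ws r) (fromStar ws all rs)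

  star? : ∀ ws → (∀ x → x ∈ᴸ ws) → Decidable (Star R)
  star? ws all u v = map′ (toStar ws) (fromStar ws all) (path? ws u v)

module _ (G : Graph) where
  open Graph G

  completeOutside? : ∀ S → Dec (CompleteOutside G S)
  completeOutside? S = all? λ u → all? λ v →
    ¬? (u ∈? S) →-dec (¬? (v ∈? S) →-dec (¬? (u ≟ v) →-dec (u ~? v)))

  covers? : ∀ T → Dec (Covers G T)
  covers? T = all? λ u → all? λ v → (u ~? v) →-dec ((u ∈? T) ⊎-dec (v ∈? T))

  inducedEdge? : ∀ T → Decidable (InducedEdge G T)
  inducedEdge? T u v = (u ∈? T) ×-dec ((v ∈? T) ×-dec (u ~? v))

  connected? : ∀ T → Dec (Connected G T)
  connected? T = all? λ u → all? λ v → (u ∈? T) →-dec ((v ∈? T) →-dec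
    star? (allFin order) ∈-allFin u v)
    where
    open Reachability _≟_ (inducedEdge? T)

  isConnectedVertexCover? : ∀ T → Dec (IsConnectedVertexCover G T)
  isConnectedVertexCover? T = covers? T ×-dec connected? T

------------------------------------------------------------------------
-- Connected Vertex Cover parameterized by a clique deletion set

valueCVC : (G : Graph) (S : Subset (Graph.order G)) → ℕ →
           Subset (Graph.order G) → ℕ ±
valueCVC G S k T =
  if does (k <? ∣ S ∣) ∨ not (does (completeOutside? G S)) then ⊥±
  else if not (does (isConnectedVertexCover? G T)) then ⊤±
  else [ ∣ T ∣ ]

CVC : Problem
CVC = record
  { Instance       = Σ Graph λ G → Subset (Graph.order G)
  ; Solution       = λ (G , S) → Subset (Graph.order G)
  ; value          = λ (G , S) → valueCVC G S
  ; encodeInstance = λ (G , S) → encodeGraph G ∙ encodeSubset S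
  ; encodeSolution = encodeSubset
  }

-- Number of vertices of the output graph.
outputOrder : ∀ {α} → ApproxKernel CVC α → Problem.Instance CVC → ℕ → ℕ
outputOrder K I k = Graph.order (proj₁ (ApproxKernel.reducedInstance K I k))

------------------------------------------------------------------------

1<α⇒α-1≢0 : ∀ {α} → 1ℚ ℚ.< α → ℚ.NonZero (α ℚ.- 1ℚ)
1<α⇒α-1≢0 {α} 1<α = ℚ.>-nonZero
  (subst (ℚ._< α ℚ.- 1ℚ) (+-inverseʳ 1ℚ) (+-monoˡ-< (ℚ.- 1ℚ) 1<α))

{-# OPTIONS --safe #-}
module Submission where

-- Let C be the clique V ∖ S and e = ⌈(2α-1)/(α-1)⌉, so that (e-1)(α-1) ≥ 1.  If
-- |C| < e, the graph has at most k + e vertices already.  Otherwise C is replaced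
-- by a clique C′ of size e one of whose vertices is joined to every vertex of S
-- that has a neighbour in C, the others to none.  A connected vertex cover
-- misses at most one vertex of the clique, and adding that vertex keeps it
-- connected, so T′ is lifted to C ∪ (T′ ∩ S), which costs at most one vertex more
-- than the exact difference |C| - e.  Conversely OPT′ ≤ OPT - (|C| - e), because
-- in the reduced graph a clique vertex without neighbours in S can be left out.
-- As T′ has at least e - 1 ≥ 1/(α-1) vertices, the extra vertex is a factor of
-- at most α.

open import Defs
open import Data.Bool.Base using (Bool; true; false; T; not; _∧_; _∨_; _xor_; if_then_else_)
open import Data.Bool.ListAction using (any)
open import Data.Bool.Properties using (T?; T-≡; T-∧; xor-comm; ∧-comm; xor-same; T-not-≡; ∨-assoc; ∨-identityʳ; ∨-zeroʳ)
open import Data.Empty using (⊥-elim)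
import Data.Fin as Fin
open import Data.Fin.Base using (Fin; zero; suc)
open import Data.Fin.Properties using (_≟_)
open import Data.Fin.Subset using (Subset; _∈_; _∉_; ∣_∣)
open import Data.Fin.Subset.Properties using (∣p∣≤n)
open import Data.Integer.Base as ℤ using (ℤ; -[1+_])
open import Data.Integer.DivMod using ([n/d]*d≤n)
import Data.Integer.Properties as ℤₚ
import Data.List.Base as List
open import Data.List.Base using (List; []; _∷_; length; foldl; foldr; map; allFin; filterᵇ; reverse; _ʳ++_)
open import Data.List.Membership.Propositional using () renaming (_∈_ to _∈ᴸ_)
open import Data.List.Membership.Propositional.Properties using (∈-allFin; ∈-filter⁺; ∈-lookup)
open import Data.List.Properties using (length-map; length-reverse; map-tabulate; tabulate-lookup; length-tabulate; map-cong; map-id; map-∘; reverse-foldl; reverse-involutive; map-is-foldr)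
import Data.List.Relation.Binary.Permutation.Propositional as Perm
open import Data.List.Relation.Binary.Permutation.Propositional using (_↭_; ↭-sym)
open import Data.List.Relation.Binary.Permutation.Propositional.Properties using (↭-reverse; ∈-resp-↭)
import Data.List.Relation.Binary.Permutation.Setoid.Properties as PermS
import Data.List.Relation.Unary.All as All
open import Data.List.Relation.Unary.All using (All; []; _∷_)
open import Data.List.Relation.Unary.AllPairs using (AllPairs; []; _∷_)
import Data.List.Relation.Unary.AllPairs.Properties as AllPairs
import Data.List.Relation.Unary.Any as Any
open import Data.List.Relation.Unary.Any using (Any; here; there; index)
open import Data.List.Relation.Unary.Any.Properties using (any⁺; any⁻; lookup-index)
open import Data.List.Relation.Unary.Unique.Propositional.Properties using (allFin⁺)
open import Data.Nat.Base using (ℕ; zero; suc; pred; _+_; _*_; _∸_; _^_; _≤_; _<_; z≤n; s≤s; s≤s⁻¹; _≡ᵇ_; _⊔_; _≤ᵇ_)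
open import Data.Nat.Properties as ℕₚ hiding (_≟_)
import Data.Nat.Tactic.RingSolver as ℕSolver
open import Data.Product.Base using (Σ; ∃; ∃₂; _×_; _,_; proj₁; proj₂; uncurry)
open import Data.Rational.Base as ℚ using (ℚ; 1ℚ; 0ℚ; *≤*; _/_; _÷_; ceiling)
import Data.Rational.Properties as ℚₚ
import Data.Rational.Solver as ℚSolver
import Data.Rational.Unnormalised.Base as ℚᵘ
import Data.Rational.Unnormalised.Properties as ℚᵘₚ
open import Data.Sum.Base using (_⊎_; inj₁; inj₂)
open import Data.Vec.Base using (Vec; []; _∷_; tabulate; toList; lookup; head; replicate)
open import Data.Vec.Properties using (length-toList; lookup∘tabulate; []=⇒lookup; lookup⇒[]=)
open import Function.Base using (_∘_; id; _on_; flip)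
open import Function.Bundles using (Equivalence)
import Relation.Binary.Construct.Closure.ReflexiveTransitive as Star
open import Relation.Binary.Construct.Closure.ReflexiveTransitive using (Star; ε; _◅_; _◅◅_)
import Relation.Binary.Construct.Add.Extrema.NonStrict as AddExtrema
open import Relation.Binary.PropositionalEquality hiding ([_])
open import Relation.Nullary using (Dec; does; yes; no; ¬_; contradiction)
open import Relation.Nullary.Construct.Add.Extrema using (_±; ⊥±; ⊤±; [_])
open import Relation.Nullary.Decidable using (dec-true; dec-false)

open Problem CVC using (Instance; Solution; encode; encodeInstance)

-- One vertex can carry all edges between `S` and the clique because the lifted cover contains the
-- whole clique: for connectivity it only matters whether a vertex of `S` has some neighbour there.
-- A second clique vertex has to be free of neighbours in `S`, as the one that a small cover of the
-- reduced graph leaves out; hence `2 ≤ e`, which holds since (2α-1)/(α-1) = 2 + 1/(α-1). Time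
-- efficiency shapes the reduction. Time is measured against the encoded graph and `S` alone, while
-- `k` is given in unary and may be far larger, so `k` is never written out: the reduced parameter
-- is the order of the reduced graph. It is at least the size of the new deletion set, so it makes
-- no solution worth -∞. If |S| > k, every solution has value -∞ and is optimal, and the empty graph
-- is put out.

infix 4 _,_⇓_≤_

-- The branches of a conditional take different times, so runs are composed with upper bounds; the
-- exact time stays as a witness because `Runs` asks for it.
_,_⇓_≤_ : ∀ {n} → Cmd n → Store n → Store n → ℕ → Set
p , σ ⇓ σ′ ≤ b = ∃ λ t → (p , σ ⇓ σ′ within t) × t ≤ b

infixr 5 _then_

_then_ : ∀ {n} {p q : Cmd n} {σ σ′ σ″ s t} →
  p , σ ⇓ σ′ ≤ s → q , σ′ ⇓ σ″ ≤ t → p ⨾ q , σ ⇓ σ″ ≤ s + t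
(_ , r , s≤) then (_ , r′ , t≤) = _ , seq r r′ , +-mono-≤ s≤ t≤

exactly : ∀ {n} {p : Cmd n} {σ σ′ t} → p , σ ⇓ σ′ within t → p , σ ⇓ σ′ ≤ t
exactly r = _ , r , ≤-refl

weaken : ∀ {n} {p : Cmd n} {σ σ′ s t} → s ≤ t → p , σ ⇓ σ′ ≤ s → p , σ ⇓ σ′ ≤ t
weaken s≤t (_ , r , q) = _ , r , ≤-trans q s≤t

if-true≤ : ∀ {n} {a} {p q : Cmd n} {σ σ′ t} → eval a σ ≢ nil →
  p , σ ⇓ σ′ ≤ t → cond a p q , σ ⇓ σ′ ≤ suc (cost a + t)
if-true≤ {a = a} a≢ (_ , r , t≤) = _ , if-true a≢ r , s≤s (+-monoʳ-≤ (cost a) t≤)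

if-false≤ : ∀ {n} {a} {p q : Cmd n} {σ σ′ t} → eval a σ ≡ nil →
  q , σ ⇓ σ′ ≤ t → cond a p q , σ ⇓ σ′ ≤ suc (cost a + t)
if-false≤ {a = a} a≡ (_ , r , t≤) = _ , if-false a≡ r , s≤s (+-monoʳ-≤ (cost a) t≤)

-- Most loops of the two kernel programs consume a list from the front while updating an
-- accumulator. `σ` gives the store for each remaining list and accumulator, so the invariant is the
-- store itself and the loop computes a `foldl`.
loop-foldl : ∀ {n} {A B : Set} (σ : List A → B → Store n) (step : B → A → B)
  {a : Exp n} {p : Cmd n} (b : ℕ) →
  (∀ acc → eval a (σ [] acc) ≡ nil) →
  (∀ x xs acc → eval a (σ (x ∷ xs) acc) ≢ nil) →
  (∀ x xs acc → p , σ (x ∷ xs) acc ⇓ σ xs (step acc x) ≤ b) →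
  ∀ xs acc →
  loop a p , σ xs acc ⇓ σ [] (foldl step acc xs)
    ≤ suc (cost a) + length xs * (suc (cost a) + b)
loop-foldl σ step {a} b stop go body [] acc =
  _ , while-false (stop acc) , ≤-reflexive (sym (+-identityʳ _))
loop-foldl σ step {a} b stop go body (x ∷ xs) acc
  with s , r , s≤ ← body x xs acc
     | t , r′ , t≤ ← loop-foldl σ step b stop go body xs (step acc x) =
  _ , while-true (go x xs acc) r r′ , (begin
    suc (cost a) + (s + t)
      ≤⟨ +-monoʳ-≤ (suc (cost a)) (+-mono-≤ s≤ t≤) ⟩
    suc (cost a) + (b + (suc (cost a) + length xs * (suc (cost a) + b)))
      ≡⟨ cong (λ z → suc (cost a) + z) (+-assoc b (suc (cost a)) _) ⟨
    suc (cost a) + ((b + suc (cost a)) + length xs * (suc (cost a) + b))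
      ≡⟨ cong (λ z → suc (cost a) + (z + length xs * (suc (cost a) + b)))
           (+-comm b (suc (cost a))) ⟩
    suc (cost a) + ((suc (cost a) + b) + length xs * (suc (cost a) + b)) ∎)
  where open ≤-Reasoning

-- Counting in lists and subsets

# : {A : Set} → (A → Bool) → List A → ℕ
# p []       = 0
# p (x ∷ xs) = if p x then suc (# p xs) else # p xs

module _ {A : Set} where

  #-cong : {p q : A → Bool} → (∀ x → p x ≡ q x) → ∀ xs → # p xs ≡ # q xs
  #-cong p≗q []       = refl
  #-cong p≗q (x ∷ xs) rewrite p≗q x | #-cong p≗q xs = refl

  #-mono : {p q : A → Bool} → (∀ x → T (p x) → T (q x)) → ∀ xs → # p xs ≤ # q xs
  #-mono             p⇒q []       = z≤n
  #-mono {p} {q} p⇒q (x ∷ xs) with p x | q x | p⇒q x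
  ... | true  | true  | _ = s≤s (#-mono p⇒q xs)
  ... | true  | false | f = ⊥-elim (f _)
  ... | false | true  | _ = m≤n⇒m≤1+n (#-mono p⇒q xs)
  ... | false | false | _ = #-mono p⇒q xs

  #-mono-< : {p q : A → Bool} → (∀ x → T (p x) → T (q x)) →
    ∀ {y xs} → y ∈ᴸ xs → T (q y) → p y ≡ false → # p xs < # q xs
  #-mono-< {p} {q} p⇒q {y} {_ ∷ xs} (here refl) qy py with p y | q y | py
  ... | false | true | _ = s≤s (#-mono p⇒q xs)
  #-mono-< {p} {q} p⇒q {y} {x ∷ xs} (there y∈) qy py with p x | q x | p⇒q x
  ... | true  | true  | _ = s≤s (#-mono-< p⇒q y∈ qy py)
  ... | true  | false | f = ⊥-elim (f _)
  ... | false | true  | _ = m≤n⇒m≤1+n (#-mono-< p⇒q y∈ qy py)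
  ... | false | false | _ = #-mono-< p⇒q y∈ qy py

  #-split : (q p : A → Bool) → ∀ xs →
    # p xs ≡ # (λ x → q x ∧ p x) xs + # (λ x → not (q x) ∧ p x) xs
  #-split q p []       = refl
  #-split q p (x ∷ xs) with q x | p x
  ... | true  | true  = cong suc (#-split q p xs)
  ... | true  | false = #-split q p xs
  ... | false | true  = trans (cong suc (#-split q p xs)) (sym (+-suc _ _))
  ... | false | false = #-split q p xs

  #-filter : (p q : A → Bool) → ∀ xs → # p (filterᵇ q xs) ≡ # (λ x → q x ∧ p x) xs
  #-filter p q []       = refl
  #-filter p q (x ∷ xs) with q x
  ... | false = #-filter p q xs
  ... | true with p x
  ...   | true  = cong suc (#-filter p q xs)
  ...   | false = #-filter p q xs

  #-map : {B : Set} (p : A → Bool) (f : B → A) → ∀ xs → # p (map f xs) ≡ # (p ∘ f) xs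
  #-map p f []       = refl
  #-map p f (x ∷ xs) rewrite #-map p f xs = refl

  #-↭ : (p : A → Bool) → ∀ {xs ys} → xs ↭ ys → # p xs ≡ # p ys
  #-↭ p Perm.refl          = refl
  #-↭ p (Perm.prep x r)    rewrite #-↭ p r = refl
  #-↭ p (Perm.swap x y r)  rewrite #-↭ p r with p x | p y
  ... | true  | true  = refl
  ... | true  | false = refl
  ... | false | true  = refl
  ... | false | false = refl
  #-↭ p (Perm.trans r r′)  = trans (#-↭ p r) (#-↭ p r′)

  length≡#+# : (p : A → Bool) → ∀ xs → length xs ≡ # p xs + # (not ∘ p) xs
  length≡#+# p []       = refl
  length≡#+# p (x ∷ xs) with p x
  ... | true  = cong suc (length≡#+# p xs)
  ... | false = trans (cong suc (length≡#+# p xs)) (sym (+-suc _ _))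

  #≡0 : (p : A → Bool) → ∀ xs → All (λ x → p x ≡ false) xs → # p xs ≡ 0
  #≡0 p []       []         = refl
  #≡0 p (x ∷ xs) (px ∷ pxs) rewrite px = #≡0 p xs pxs

  -- `R` separates the entries, so two of them satisfying `p` clash. It is applied to the clique
  -- vertices outside a vertex cover, two of which would span an uncovered edge.
  #≤1 : {R : A → A → Set} (p : A → Bool) → ∀ {xs} →
    (∀ {x y} → x ∈ᴸ xs → y ∈ᴸ xs → T (p x) → T (p y) → ¬ R x y) →
    AllPairs R xs → # p xs ≤ 1
  #≤1     p clash []       = z≤n
  #≤1 {R} p {x ∷ xs} clash (r ∷ rs) with p x in px
  ... | false = #≤1 p (λ x∈ y∈ → clash (there x∈) (there y∈)) rs
  ... | true  = s≤s (≤-reflexive (#≡0 p xs (All.tabulate lemma)))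
    where
    lemma : ∀ {y} → y ∈ᴸ xs → p y ≡ false
    lemma {y} y∈ with p y in py
    ... | false = refl
    ... | true  = contradiction (All.lookup r y∈)
      (clash (here refl) (there y∈) (Equivalence.from T-≡ px) (Equivalence.from T-≡ py))

  lookup-injective : {B : Set} (f : A → B) {xs : List A} →
    AllPairs (_≢_ on f) xs → ∀ i j →
    f (List.lookup xs i) ≡ f (List.lookup xs j) → i ≡ j
  lookup-injective f (r ∷ rs) zero    zero    eq = refl
  lookup-injective f (r ∷ rs) zero    (suc j) eq =
    contradiction eq (All.lookup r (∈-lookup j))
  lookup-injective f (r ∷ rs) (suc i) zero    eq =
    contradiction (sym eq) (All.lookup r (∈-lookup i))
  lookup-injective f (r ∷ rs) (suc i) (suc j) eq =
    cong suc (lookup-injective f rs i j eq)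

  map-lookup-allFin : {B : Set} (f : A → B) → ∀ xs →
    map (f ∘ List.lookup xs) (allFin (length xs)) ≡ map f xs
  map-lookup-allFin f xs = trans (map-tabulate id (f ∘ List.lookup xs))
    (trans (sym (map-tabulate (List.lookup xs) f)) (cong (map f) (tabulate-lookup xs)))

∣∣≡# : ∀ {n} (S : Subset n) → ∣ S ∣ ≡ # id (toList S)
∣∣≡# []          = refl
∣∣≡# (true ∷ S)  = cong suc (∣∣≡# S)
∣∣≡# (false ∷ S) = ∣∣≡# S

toList≡map-lookup : ∀ {A : Set} {n} (xs : Vec A n) → toList xs ≡ map (lookup xs) (allFin n)
toList≡map-lookup xs = trans (lemma xs) (sym (map-tabulate id (lookup xs)))
  where
  lemma : ∀ {A : Set} {n} (xs : Vec A n) → toList xs ≡ List.tabulate (lookup xs)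
  lemma []       = refl
  lemma (x ∷ xs) = cong (x ∷_) (lemma xs)

toList-tabulate : ∀ {A : Set} {n} (f : Fin n → A) → toList (tabulate f) ≡ map f (allFin n)
toList-tabulate f = trans (toList≡map-lookup (tabulate f)) (map-cong (lookup∘tabulate f) (allFin _))

∣∣≡#lookup : ∀ {n} (S : Subset n) → ∣ S ∣ ≡ # (lookup S) (allFin n)
∣∣≡#lookup S = trans (∣∣≡# S) (trans (cong (# id) (toList≡map-lookup S)) (#-map id (lookup S) (allFin _)))

∣tabulate∣ : ∀ {n} (f : Fin n → Bool) → ∣ tabulate f ∣ ≡ # f (allFin n)
∣tabulate∣ f = trans (∣∣≡#lookup (tabulate f)) (#-cong (lookup∘tabulate f) (allFin _))

∣tabulate-lookup∣ : ∀ {A : Set} (f : A → Bool) (xs : List A) →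
  ∣ tabulate (f ∘ List.lookup xs) ∣ ≡ # f xs
∣tabulate-lookup∣ f xs = begin
  ∣ tabulate (f ∘ List.lookup xs) ∣             ≡⟨ ∣tabulate∣ (f ∘ List.lookup xs) ⟩
  # (f ∘ List.lookup xs) (allFin (length xs))   ≡⟨ #-map id (f ∘ List.lookup xs) (allFin (length xs)) ⟨
  # id (map (f ∘ List.lookup xs) (allFin (length xs)))
                                                ≡⟨ cong (# id) (map-lookup-allFin f xs) ⟩
  # id (map f xs)                               ≡⟨ #-map id f xs ⟩
  # f xs                                        ∎
  where open ≡-Reasoning

∈⇒T : ∀ {n} {S : Subset n} {v} → v ∈ S → T (lookup S v)
∈⇒T v∈ = Equivalence.from T-≡ ([]=⇒lookup v∈)

T⇒∈ : ∀ {n} {S : Subset n} {v} → T (lookup S v) → v ∈ S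
T⇒∈ {S = S} {v} t = lookup⇒[]= v S (Equivalence.to T-≡ t)

∈-tabulate⁺ : ∀ {n} {f : Fin n → Bool} {v} → T (f v) → v ∈ tabulate f
∈-tabulate⁺ {f = f} {v} t = T⇒∈ (subst T (sym (lookup∘tabulate f v)) t)

∈-tabulate⁻ : ∀ {n} {f : Fin n → Bool} {v} → v ∈ tabulate f → T (f v)
∈-tabulate⁻ {f = f} {v} v∈ = subst T (lookup∘tabulate f v) (∈⇒T v∈)

-- Truncated at 0, as `tl` leaves `nil` alone on the codes of the counters.
predIf : Bool → ℕ → ℕ
predIf true  c = pred c
predIf false c = c

predIf-∸ : ∀ {A : Set} (p : A → Bool) x xs c → predIf (p x) c ∸ # p xs ≡ c ∸ # p (x ∷ xs)
predIf-∸ p x xs c with p x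
... | false = refl
predIf-∸ p x xs zero    | true = 0∸n≡0 (# p xs)
predIf-∸ p x xs (suc c) | true = refl

-- The shrunken graph

-- The members of S and the first e vertices outside S are kept.  Each vertex
-- is paired with the number of clique vertices that may still be kept when it
-- is reached, so these numbers run through e, e - 1, …, 1 on the kept ones;
-- the clique vertex with number 1 is joined to every vertex of S that had a
-- neighbour in the clique, the other clique vertices to none.
module Shrink (G : Graph) (S : Subset (Graph.order G)) (e : ℕ) where
  open Graph G renaming (order to n)

  Item : Set
  Item = Fin n × ℕ

  inS outS : Fin n → Bool
  inS  = lookup S
  outS = not ∘ inS

  attached : Fin n → Bool
  attached v = any (λ w → adj v w ∧ outS w) (allFin n)

  kept port : Item → Bool
  kept (v , c) = inS v ∨ not (c ≡ᵇ 0)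
  port (v , c) = if inS v then attached v else c ≡ᵇ 1

  -- Only edges between the two sides are replaced; on each side `adj` is inherited, so kept clique
  -- vertices keep their mutual edges.
  joined : Item → Item → Bool
  joined x y =
    if inS (proj₁ x) xor inS (proj₁ y) then port x ∧ port y else adj (proj₁ x) (proj₁ y)

  mark : ℕ → List (Fin n) → List Item
  mark c []       = []
  mark c (v ∷ vs) = (v , c) ∷ mark (predIf (outS v) c) vs

  -- The first pass pushes the items, which leaves them reversed. The order of `L` suits both
  -- programs: building the graph runs through `marked` and pushes what is kept, lifting runs
  -- through `scanned` itself.
  marked scanned L : List Item
  marked  = mark e (allFin n)
  scanned = reverse marked
  L       = filterᵇ kept scanned

  nth : Fin (length L) → Item
  nth = List.lookup L

  shrunk : Graph
  shrunk = record
    { order      = length L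
    ; adj        = λ i j → joined (nth i) (nth j)
    ; adj-sym    = λ i j → joined-sym (nth i) (nth j)
    ; adj-irrefl = λ i → joined-irrefl (nth i)
    }
    where
    joined-sym : ∀ x y → joined x y ≡ joined y x
    joined-sym x y
      rewrite xor-comm (inS (proj₁ x)) (inS (proj₁ y)) | ∧-comm (port x) (port y)
            | adj-sym (proj₁ x) (proj₁ y) = refl
    joined-irrefl : ∀ x → joined x x ≡ false
    joined-irrefl (v , c) rewrite xor-same (inS v) = adj-irrefl v

  shrunkS : Subset (length L)
  shrunkS = tabulate (inS ∘ proj₁ ∘ nth)

  #S #C : ℕ
  #S = # inS (allFin n)
  #C = # outS (allFin n)

  map-proj₁-mark : ∀ c vs → map proj₁ (mark c vs) ≡ vs
  map-proj₁-mark c []       = refl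
  map-proj₁-mark c (v ∷ vs) = cong (v ∷_) (map-proj₁-mark _ vs)

  ∈-mark : ∀ c {v vs} → v ∈ᴸ vs → ∃ λ c′ → (v , c′) ∈ᴸ mark c vs
  ∈-mark c (here refl) = c , here refl
  ∈-mark c (there v∈) with c′ , i ← ∈-mark _ v∈ = c′ , there i

  ∈-L : ∀ {x} → x ∈ᴸ marked → T (kept x) → x ∈ᴸ L
  ∈-L x∈ k = ∈-filter⁺ (T? ∘ kept) (∈-resp-↭ (↭-sym (↭-reverse marked)) x∈) k

  unique-L : AllPairs (_≢_ on proj₁) L
  unique-L = AllPairs.filter⁺ (T? ∘ kept)
    (PermS.AllPairs-resp-↭ (setoid Item) (λ r → r ∘ sym)
      ((λ where refl r → r) , (λ where refl r → r))
      (Perm.↭⇒↭ₛ (↭-sym (↭-reverse marked)))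
      (AllPairs.map⁻ (subst (AllPairs _≢_) (sym (map-proj₁-mark e (allFin n))) (allFin⁺ n))))

  -- Members of `S` are always kept, so a count confined to `S` survives the filter.
  #-L : (p : Fin n → Bool) → (∀ v → T (p v) → T (inS v)) →
    # (p ∘ proj₁) L ≡ # p (allFin n)
  #-L p p⇒S = begin
    # (p ∘ proj₁) L                              ≡⟨ #-filter (p ∘ proj₁) kept scanned ⟩
    # (λ x → kept x ∧ p (proj₁ x)) scanned       ≡⟨ #-cong lemma scanned ⟩
    # (p ∘ proj₁) scanned                        ≡⟨ #-↭ (p ∘ proj₁) (↭-reverse marked) ⟩
    # (p ∘ proj₁) marked                         ≡⟨ #-map p proj₁ marked ⟨
    # p (map proj₁ marked)                       ≡⟨ cong (# p) (map-proj₁-mark e (allFin n)) ⟩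
    # p (allFin n)                               ∎
    where
    open ≡-Reasoning
    lemma : ∀ x → kept x ∧ p (proj₁ x) ≡ p (proj₁ x)
    lemma (v , c) with inS v | p v | p⇒S v
    ... | true  | b     | _ = refl
    ... | false | true  | f = ⊥-elim (f _)
    ... | false | false | _ with c ≡ᵇ 0
    ...   | true  = refl
    ...   | false = refl

  -- The countdown drops once per clique vertex, so exactly the first `c` of them meet a nonzero
  -- number.
  #outS-mark : ∀ c vs → c ≤ # outS vs →
    # (λ x → kept x ∧ outS (proj₁ x)) (mark c vs) ≡ c
  #outS-mark c       []       z≤n = refl
  #outS-mark c       (v ∷ vs) c≤ with inS v
  #outS-mark c       (v ∷ vs) c≤       | true  = #outS-mark c vs c≤
  #outS-mark zero    (v ∷ vs) c≤       | false = #outS-mark zero vs z≤n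
  #outS-mark (suc c) (v ∷ vs) (s≤s c≤) | false = cong suc (#outS-mark c vs c≤)

  -- Supplies the two clique vertices on which correctness rests: number 1, the port, and number 2,
  -- which gets no neighbour in `S`.
  ∃-mark : ∀ c vs j → c ≤ # outS vs → 1 ≤ j → j ≤ c →
    ∃ λ v → (v , j) ∈ᴸ mark c vs × inS v ≡ false
  ∃-mark c       []       j z≤n (s≤s _) ()
  ∃-mark c       (v ∷ vs) j c≤ 1≤j j≤c with inS v in eq
  ... | true with w , w∈ , out ← ∃-mark c vs j c≤ 1≤j j≤c = w , there w∈ , out
  ∃-mark zero    (v ∷ vs) j c≤ (s≤s _) () | false
  ∃-mark (suc c) (v ∷ vs) j (s≤s c≤) 1≤j j≤c | false with m≤n⇒m<n∨m≡n j≤c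
  ... | inj₂ refl = v , here refl , eq
  ... | inj₁ (s≤s j≤)
    with w , w∈ , out ← ∃-mark c vs j c≤ 1≤j j≤ = w , there w∈ , out

  #outS-L : e ≤ #C → # (outS ∘ proj₁) L ≡ e
  #outS-L e≤ = trans (#-filter (outS ∘ proj₁) kept scanned)
    (trans (#-↭ _ (↭-reverse marked)) (#outS-mark e (allFin n) e≤))

  order≡ : e ≤ #C → length L ≡ #S + e
  order≡ e≤ = trans (length≡#+# (inS ∘ proj₁) L)
    (cong₂ _+_ (#-L inS (λ _ t → t)) (#outS-L e≤))

  -- Membership in `T′` read at the vertices of `G`; false at every vertex that was dropped.
  restored : Subset (length L) → Fin n → Bool
  restored T′ v = any (λ i → does (proj₁ (nth i) ≟ v) ∧ lookup T′ i) (allFin (length L))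

  nth-injective : ∀ i j → proj₁ (nth i) ≡ proj₁ (nth j) → i ≡ j
  nth-injective = lookup-injective proj₁ unique-L

  restored-nth : ∀ T′ i → restored T′ (proj₁ (nth i)) ≡ lookup T′ i
  restored-nth T′ i with restored T′ (proj₁ (nth i)) in eqR | lookup T′ i in eqL
  ... | true  | true  = refl
  ... | false | false = refl
  ... | false | true  = contradiction
    (any⁺ (λ k → does (proj₁ (nth k) ≟ proj₁ (nth i)) ∧ lookup T′ k)
      (Any.map (λ where refl → hit) (∈-allFin i)))
    (λ t → subst T eqR t)
    where
    hit : T (does (proj₁ (nth i) ≟ proj₁ (nth i)) ∧ lookup T′ i)
    hit rewrite dec-true (proj₁ (nth i) ≟ proj₁ (nth i)) refl | eqL = _
  ... | true  | false
    with k , t ← Any.satisfied (any⁻ _ (allFin (length L)) (Equivalence.from T-≡ eqR))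
    with proj₁ (nth k) ≟ proj₁ (nth i)
  ... | yes eq with refl ← nth-injective k i eq = ⊥-elim (subst T eqL t)

  extended : Subset (length L) → Subset n
  extended T′ = tabulate λ v → if inS v then restored T′ v else true

  nth⁻¹ : ∀ {x} → x ∈ᴸ L → ∃ λ i → nth i ≡ x
  nth⁻¹ x∈ = index x∈ , sym (lookup-index x∈)

  S-item : ∀ {v} → inS v ≡ true → ∃ λ i → proj₁ (nth i) ≡ v
  S-item {v} eq with c , x∈ ← ∈-mark e (∈-allFin v)
    with i , eqI ← nth⁻¹ (∈-L x∈ (subst (λ b → T (b ∨ not (c ≡ᵇ 0))) (sym eq) _))
    = i , cong proj₁ eqI

-- Connected vertex covers of the original and of the shrunken graph

module Correct (G : Graph) (S : Subset (Graph.order G)) (e : ℕ) where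
  open Graph G renaming (order to n)
  open Shrink G S e

  module G′ = Graph shrunk

  side : ∀ v → inS v ≡ true ⊎ inS v ≡ false
  side v with inS v
  ... | true  = inj₁ refl
  ... | false = inj₂ refl

  outS-true : ∀ {v} → inS v ≡ false → outS v ≡ true
  outS-true = cong not

  edge-symmetric : ∀ {u v} → u ~ v → v ~ u
  edge-symmetric {u} {v} = subst T (adj-sym u v)

  joined-SS : ∀ {x y} → inS (proj₁ x) ≡ true → inS (proj₁ y) ≡ true →
    joined x y ≡ adj (proj₁ x) (proj₁ y)
  joined-SS p q rewrite p | q = refl

  joined-CC : ∀ {x y} → inS (proj₁ x) ≡ false → inS (proj₁ y) ≡ false →
    joined x y ≡ adj (proj₁ x) (proj₁ y)
  joined-CC p q rewrite p | q = refl

  joined-SC : ∀ {x y} → inS (proj₁ x) ≡ true → inS (proj₁ y) ≡ false →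
    joined x y ≡ attached (proj₁ x) ∧ (proj₂ y ≡ᵇ 1)
  joined-SC p q rewrite p | q = refl

  attached⁺ : ∀ {v w} → v ~ w → inS w ≡ false → T (attached v)
  attached⁺ {v} {w} v~w w∉ = any⁺ (λ w → adj v w ∧ outS w)
    (Any.map (λ where refl → Equivalence.from T-∧ (v~w , Equivalence.from T-≡ (outS-true w∉)))
      (∈-allFin w))

  attached⁻ : ∀ {v} → T (attached v) → ∃ λ w → v ~ w × inS w ≡ false
  attached⁻ {v} t
    with w , t′ ← Any.satisfied (any⁻ (λ w → adj v w ∧ outS w) (allFin n) t)
    with v~w , w∉ ← Equivalence.to T-∧ t′ = w , v~w , Equivalence.to T-not-≡ w∉

  module _ (clique : CompleteOutside G S) where

    clique~ : ∀ {u v} → inS u ≡ false → inS v ≡ false → u ≢ v → u ~ v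
    clique~ {u} {v} u∉ v∉ = clique u v (out u∉) (out v∉)
      where
      out : ∀ {v} → inS v ≡ false → v ∉ S
      out v∉ v∈ with () ← trans (sym ([]=⇒lookup v∈)) v∉

    #uncovered≤1 : ∀ {T} → Covers G T → # (λ v → not (lookup T v) ∧ outS v) (allFin n) ≤ 1
    #uncovered≤1 {T} cov = #≤1 (λ v → not (lookup T v) ∧ outS v) clash (allFin⁺ n)
      where
      clash : ∀ {x y} → x ∈ᴸ allFin n → y ∈ᴸ allFin n → _ → _ → ¬ (x ≢ y)
      clash {x} {y} _ _ tx ty x≢y
        with nx , cx ← Equivalence.to (T-∧ {not (lookup T x)}) tx
           | ny , cy ← Equivalence.to (T-∧ {not (lookup T y)}) ty
        with cov x y (clique~ (Equivalence.to T-not-≡ cx) (Equivalence.to T-not-≡ cy) x≢y)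
      ... | inj₁ x∈ with () ← trans (sym ([]=⇒lookup x∈)) (Equivalence.to T-not-≡ nx)
      ... | inj₂ y∈ with () ← trans (sym ([]=⇒lookup y∈)) (Equivalence.to T-not-≡ ny)

  module Large (e≤#C : e ≤ #C) (2≤e : 2 ≤ e) (clique : CompleteOutside G S) where

    private
      clique-item : ∀ j → 1 ≤ j → j ≤ e → ∃ λ i → ∃ λ v → nth i ≡ (v , j) × inS v ≡ false
      clique-item (suc j) 1≤j j≤e
        with v , x∈ , v∉ ← ∃-mark e (allFin n) (suc j) e≤#C 1≤j j≤e
        with i , eq ← nth⁻¹ (∈-L x∈ (subst (λ b → T (b ∨ true)) (sym v∉) _))
        = i , v , eq , v∉

    item₁ = clique-item 1 (s≤s z≤n) (≤-trans (s≤s z≤n) 2≤e)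
    item₂ = clique-item 2 (s≤s z≤n) 2≤e

    i₁ = proj₁ item₁
    v₁ = proj₁ (proj₂ item₁)
    nth-i₁ : nth i₁ ≡ (v₁ , 1)
    nth-i₁ = proj₁ (proj₂ (proj₂ item₁))
    v₁∉S : inS v₁ ≡ false
    v₁∉S = proj₂ (proj₂ (proj₂ item₁))

    i₂ = proj₁ item₂
    v₂ = proj₁ (proj₂ item₂)
    nth-i₂ : nth i₂ ≡ (v₂ , 2)
    nth-i₂ = proj₁ (proj₂ (proj₂ item₂))
    v₂∉S : inS v₂ ≡ false
    v₂∉S = proj₂ (proj₂ (proj₂ item₂))

    same-item : ∀ i j → proj₁ (nth i) ≡ proj₁ (nth j) → nth i ≡ nth j
    same-item i j eq = cong nth (nth-injective i j eq)

    v₁≢v₂ : v₁ ≢ v₂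
    v₁≢v₂ eq with () ← trans (sym (cong proj₂ nth-i₁)) (trans (cong proj₂
      (same-item i₁ i₂ (trans (cong proj₁ nth-i₁) (trans eq (sym (cong proj₁ nth-i₂))))))
      (cong proj₂ nth-i₂))

    clique-edge : ∀ i j → inS (proj₁ (nth i)) ≡ false → inS (proj₁ (nth j)) ≡ false →
      proj₁ (nth i) ≢ proj₁ (nth j) → T (joined (nth i) (nth j))
    clique-edge i j i∉ j∉ i≢j =
      subst T (sym (joined-CC {nth i} {nth j} i∉ j∉)) (clique~ clique i∉ j∉ i≢j)

    v₁≡ : proj₁ (nth i₁) ≡ v₁
    v₁≡ = cong proj₁ nth-i₁

    v₂≡ : proj₁ (nth i₂) ≡ v₂
    v₂≡ = cong proj₁ nth-i₂

    -- From a cover of the shrunken graph to one of the original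

    module Extend {T′} (cvc : IsConnectedVertexCover shrunk T′) where
      T* : Subset n
      T* = extended T′

      out∈ : ∀ {v} → inS v ≡ false → v ∈ T*
      out∈ {v} v∉ = ∈-tabulate⁺ (subst (λ b → T (if b then restored T′ v else true)) (sym v∉) _)

      in∈ : ∀ {i} → inS (proj₁ (nth i)) ≡ true → i ∈ T′ → proj₁ (nth i) ∈ T*
      in∈ {i} i∈S i∈ = ∈-tabulate⁺ (subst (λ b → T (if b then restored T′ (proj₁ (nth i)) else true))
        (sym i∈S) (subst T (sym (restored-nth T′ i)) (∈⇒T i∈)))

      in∈⁻ : ∀ {v} → inS v ≡ true → v ∈ T* → T (restored T′ v)
      in∈⁻ {v} v∈S v∈ = subst (λ b → T (if b then restored T′ v else true)) v∈S (∈-tabulate⁻ v∈)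

      covers : Covers G T*
      covers u v u~v with side u | side v
      ... | inj₂ u∉ | _       = inj₁ (out∈ u∉)
      ... | _       | inj₂ v∉ = inj₂ (out∈ v∉)
      ... | inj₁ u∈ | inj₁ v∈ with i , refl ← S-item u∈ | j , refl ← S-item v∈
        with proj₁ cvc i j (subst T (sym (joined-SS {nth i} {nth j} u∈ v∈)) u~v)
      ... | inj₁ i∈ = inj₁ (in∈ u∈ i∈)
      ... | inj₂ j∈ = inj₂ (in∈ v∈ j∈)

      -- The edge between the clique vertices 1 and 2 is covered. The end found gives walks in `T′`
      -- from `S` a target in the clique.
      anchor : ∃ λ j → j ∈ T′ × inS (proj₁ (nth j)) ≡ false
      anchor
        with proj₁ cvc i₁ i₂ (clique-edge i₁ i₂ (trans (cong inS v₁≡) v₁∉S)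
               (trans (cong inS v₂≡) v₂∉S) λ eq → v₁≢v₂ (trans (sym v₁≡) (trans eq v₂≡)))
      ... | inj₁ i∈ = i₁ , i∈ , trans (cong inS v₁≡) v₁∉S
      ... | inj₂ i∈ = i₂ , i∈ , trans (cong inS v₂≡) v₂∉S

      from-clique : ∀ {w} → inS w ≡ false → Star (InducedEdge G T*) w v₁
      from-clique {w} w∉ with w ≟ v₁
      ... | yes refl = ε
      ... | no w≢    = (out∈ w∉ , out∈ v₁∉S , clique~ clique w∉ v₁∉S w≢) ◅ ε

      -- The walk is copied while it stays in `S` and dropped at its first clique vertex. That step
      -- ends in the port, so the last vertex of `S` on it is `attached`; its true neighbour in the
      -- clique lies in `T*`, as all of the clique does.
      from-S : ∀ {i j} → Star (InducedEdge shrunk T′) i j →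
        inS (proj₁ (nth i)) ≡ true → inS (proj₁ (nth j)) ≡ false →
        Star (InducedEdge G T*) (proj₁ (nth i)) v₁
      from-S ε i∈ j∉ with () ← trans (sym i∈) j∉
      from-S (_◅_ {i} {k} (i∈ , k∈ , i~k) rest) i∈S j∉ with side (proj₁ (nth k))
      ... | inj₁ k∈S = (in∈ i∈S i∈ , in∈ k∈S k∈ ,
              subst T (joined-SS {nth i} {nth k} i∈S k∈S) i~k) ◅ from-S rest k∈S j∉
      ... | inj₂ k∉S
        with t , _ ← Equivalence.to T-∧ (subst T (joined-SC {nth i} {nth k} i∈S k∉S) i~k)
        with w , i~w , w∉ ← attached⁻ t =
          (in∈ i∈S i∈ , out∈ w∉ , i~w) ◅ from-clique w∉

      to-v₁ : ∀ {v} → v ∈ T* → Star (InducedEdge G T*) v v₁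
      to-v₁ {v} v∈ with side v
      ... | inj₂ v∉ = from-clique v∉
      ... | inj₁ v∈S with i , refl ← S-item v∈S | j , j∈ , j∉ ← anchor =
        from-S (proj₂ cvc i j (T⇒∈ (subst T (restored-nth T′ i) (in∈⁻ v∈S v∈))) j∈) v∈S j∉

      connected : Connected G T*
      connected u v u∈ v∈ = to-v₁ u∈ ◅◅
        Star.reverse (λ (a∈ , b∈ , a~b) → b∈ , a∈ , edge-symmetric a~b) (to-v₁ v∈)

      isCVC : IsConnectedVertexCover G T*
      isCVC = covers , connected

      private
        r : Fin n → Bool
        r = restored T′

        ∣T′∣≡ : ∣ T′ ∣ ≡ # (r ∘ proj₁) L
        ∣T′∣≡ = begin
          ∣ T′ ∣                                   ≡⟨ ∣∣≡#lookup T′ ⟩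
          # (lookup T′) (allFin (length L))        ≡⟨ #-cong (restored-nth T′) (allFin (length L)) ⟨
          # (r ∘ proj₁ ∘ nth) (allFin (length L))  ≡⟨ ∣tabulate∣ (r ∘ proj₁ ∘ nth) ⟨
          ∣ tabulate (r ∘ proj₁ ∘ nth) ∣           ≡⟨ ∣tabulate-lookup∣ (r ∘ proj₁) L ⟩
          # (r ∘ proj₁) L                          ∎
          where open ≡-Reasoning

        inner missed : ℕ
        inner  = # (λ v → inS v ∧ r v) (allFin n)
        missed = # (λ x → not (r (proj₁ x)) ∧ outS (proj₁ x)) L

        missed≤1 : missed ≤ 1
        missed≤1 = #≤1 (λ x → not (r (proj₁ x)) ∧ outS (proj₁ x)) clash unique-L
          where
          clash : ∀ {x y} → x ∈ᴸ L → y ∈ᴸ L → _ → _ → ¬ (proj₁ x ≢ proj₁ y)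
          clash x∈ y∈ tx ty x≢y
            with i , refl ← nth⁻¹ x∈ | j , refl ← nth⁻¹ y∈
            with nx , cx ← Equivalence.to (T-∧ {not (r (proj₁ (nth i)))}) tx
               | ny , cy ← Equivalence.to (T-∧ {not (r (proj₁ (nth j)))}) ty
            with proj₁ cvc i j (clique-edge i j
                   (Equivalence.to T-not-≡ cx) (Equivalence.to T-not-≡ cy) x≢y)
          ... | inj₁ i∈ with () ← trans (sym ([]=⇒lookup i∈))
                  (trans (sym (restored-nth T′ i)) (Equivalence.to T-not-≡ nx))
          ... | inj₂ j∈ with () ← trans (sym ([]=⇒lookup j∈))
                  (trans (sym (restored-nth T′ j)) (Equivalence.to T-not-≡ ny))

        outer : ℕ
        outer = # (λ x → outS (proj₁ x) ∧ r (proj₁ x)) L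

        ∣T′∣-split : ∣ T′ ∣ ≡ inner + outer
        ∣T′∣-split = trans ∣T′∣≡ (trans (#-split (inS ∘ proj₁) (r ∘ proj₁) L)
          (cong (_+ outer) (#-L (λ v → inS v ∧ r v) (λ v t → proj₁ (Equivalence.to T-∧ t)))))

        e≤outer : e ≤ suc outer
        e≤outer = begin
          e                                                 ≡⟨ #outS-L e≤#C ⟨
          # (outS ∘ proj₁) L                                ≡⟨ #-split (r ∘ proj₁) (outS ∘ proj₁) L ⟩
          # (λ x → r (proj₁ x) ∧ outS (proj₁ x)) L + missed
            ≡⟨ cong (_+ missed) (#-cong (λ x → ∧-comm (r (proj₁ x)) (outS (proj₁ x))) L) ⟩
          outer + missed                                    ≤⟨ +-monoʳ-≤ outer missed≤1 ⟩
          outer + 1                                         ≡⟨ +-comm outer 1 ⟩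
          suc outer                                         ∎
          where open ≤-Reasoning

        ∣T*∣≡ : ∣ T* ∣ ≡ inner + #C
        ∣T*∣≡ = trans (∣tabulate∣ t) (trans (#-split inS t (allFin n))
          (cong₂ _+_ (#-cong in-part (allFin n)) (#-cong out-part (allFin n))))
          where
          t : Fin n → Bool
          t v = if inS v then r v else true
          in-part : ∀ v → inS v ∧ t v ≡ inS v ∧ r v
          in-part v with inS v
          ... | true  = refl
          ... | false = refl
          out-part : ∀ v → outS v ∧ t v ≡ outS v
          out-part v with inS v
          ... | true  = refl
          ... | false = refl

      e≤∣T′∣ : e ≤ suc ∣ T′ ∣
      e≤∣T′∣ = ≤-trans e≤outer (s≤s (subst (outer ≤_) (sym ∣T′∣-split) (m≤n+m outer inner)))

      -- `T*` and `T′` agree inside `S`, so only the clique parts `#C` and `outer` are compared. The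
      -- additive form avoids the truncated difference of `#C` and `e`.
      size-bound : ∣ T* ∣ + e ≤ suc ∣ T′ ∣ + #C
      size-bound = begin
        ∣ T* ∣ + e                  ≡⟨ cong (_+ e) ∣T*∣≡ ⟩
        inner + #C + e              ≤⟨ +-monoʳ-≤ (inner + #C) e≤outer ⟩
        inner + #C + suc outer      ≡⟨ +-assoc inner #C (suc outer) ⟩
        inner + (#C + suc outer)    ≡⟨ cong (λ z → inner + z) (+-comm #C (suc outer)) ⟩
        inner + (suc outer + #C)    ≡⟨ +-assoc inner (suc outer) #C ⟨
        inner + suc outer + #C      ≡⟨ cong (_+ #C) (+-suc inner outer) ⟩
        suc (inner + outer) + #C    ≡⟨ cong (λ z → suc z + #C) ∣T′∣-split ⟨
        suc ∣ T′ ∣ + #C             ∎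
        where open ≤-Reasoning

    -- From a cover of the original graph to one of the shrunken graph

    module Restrict {T*} (cvc : IsConnectedVertexCover G T*) where

      -- Whatever `T*` does on the clique is forgotten: all kept clique vertices are taken except
      -- `v₂`, which has no neighbour in `S`. The port `v₁` is among those taken.
      q : Fin n → Bool
      q v = if inS v then lookup T* v else not (does (v ≟ v₂))

      T′ : Subset (length L)
      T′ = tabulate (q ∘ proj₁ ∘ nth)

      in∈ : ∀ {i} → inS (proj₁ (nth i)) ≡ true → proj₁ (nth i) ∈ T* → i ∈ T′
      in∈ {i} i∈S i∈ = ∈-tabulate⁺
        (subst (λ b → T (if b then lookup T* (proj₁ (nth i)) else not (does (proj₁ (nth i) ≟ v₂))))
          (sym i∈S) (∈⇒T i∈))

      in∈⁻ : ∀ {i} → inS (proj₁ (nth i)) ≡ true → i ∈ T′ → proj₁ (nth i) ∈ T*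
      in∈⁻ {i} i∈S i∈ = T⇒∈
        (subst (λ b → T (if b then lookup T* (proj₁ (nth i)) else not (does (proj₁ (nth i) ≟ v₂))))
          i∈S (∈-tabulate⁻ i∈))

      out∈ : ∀ {i} → inS (proj₁ (nth i)) ≡ false → proj₁ (nth i) ≢ v₂ → i ∈ T′
      out∈ {i} i∉S i≢ = ∈-tabulate⁺
        (subst (λ b → T (if b then lookup T* (proj₁ (nth i)) else not (does (proj₁ (nth i) ≟ v₂))))
          (sym i∉S) (subst (T ∘ not) (sym (dec-false (proj₁ (nth i) ≟ v₂) i≢)) _))

      port≢v₂ : ∀ j → T (proj₂ (nth j) ≡ᵇ 1) → proj₁ (nth j) ≢ v₂
      port≢v₂ j t eq = subst (λ x → ¬ T (proj₂ x ≡ᵇ 1)) (sym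
        (trans (same-item j i₂ (trans eq (sym v₂≡))) nth-i₂)) (λ ()) t

      -- Edges inside `S` are covered as in `G`. An edge between `S` and the clique ends in the
      -- port, and an edge of the clique has an end other than `v₂`.
      covers : Covers shrunk T′
      covers i j i~j with side (proj₁ (nth i)) | side (proj₁ (nth j))
      ... | inj₁ i∈S | inj₁ j∈S
        with proj₁ cvc _ _ (subst T (joined-SS {nth i} {nth j} i∈S j∈S) i~j)
      ...   | inj₁ i∈ = inj₁ (in∈ i∈S i∈)
      ...   | inj₂ j∈ = inj₂ (in∈ j∈S j∈)
      covers i j i~j | inj₁ i∈S | inj₂ j∉S = inj₂ (out∈ j∉S (port≢v₂ j
        (proj₂ (Equivalence.to (T-∧ {attached (proj₁ (nth i))})
          (subst T (joined-SC {nth i} {nth j} i∈S j∉S) i~j)))))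
      covers i j i~j | inj₂ i∉S | inj₁ j∈S = inj₁ (out∈ i∉S (port≢v₂ i
        (proj₂ (Equivalence.to (T-∧ {attached (proj₁ (nth j))})
          (subst T (joined-SC {nth j} {nth i} j∈S i∉S) (subst T (G′.adj-sym i j) i~j))))))
      covers i j i~j | inj₂ i∉S | inj₂ j∉S with proj₁ (nth i) ≟ v₂ | proj₁ (nth j) ≟ v₂
      ... | no i≢  | _      = inj₁ (out∈ i∉S i≢)
      ... | _      | no j≢  = inj₂ (out∈ j∉S j≢)
      ... | yes i≡ | yes j≡ with refl ← nth-injective i j (trans i≡ (sym j≡)) =
        ⊥-elim (subst T (G′.adj-irrefl i) i~j)

      i₁∈ : i₁ ∈ T′
      i₁∈ = out∈ (trans (cong inS v₁≡) v₁∉S) (λ eq → v₁≢v₂ (trans (sym v₁≡) eq))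

      anchor : ∃ λ c → c ∈ T* × inS c ≡ false
      anchor with proj₁ cvc v₁ v₂ (clique~ clique v₁∉S v₂∉S v₁≢v₂)
      ... | inj₁ v∈ = v₁ , v∈ , v₁∉S
      ... | inj₂ v∈ = v₂ , v∈ , v₂∉S

      -- The walk in `G` is cut at its first clique vertex: having that neighbour makes the
      -- preceding vertex of `S` `attached`, hence adjacent to the port `i₁`.
      from-S : ∀ {u c} → Star (InducedEdge G T*) u c → inS c ≡ false →
        ∀ i → proj₁ (nth i) ≡ u → inS u ≡ true → Star (InducedEdge shrunk T′) i i₁
      from-S ε c∉ i refl u∈ with () ← trans (sym u∈) c∉
      from-S (_◅_ {j = w} (u∈ , w∈ , u~w) rest) c∉ i refl u∈S with side w
      ... | inj₁ w∈S with k , refl ← S-item w∈S =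
        (in∈ u∈S u∈ , in∈ w∈S w∈ , subst T (sym (joined-SS {nth i} {nth k} u∈S w∈S)) u~w)
          ◅ from-S rest c∉ k refl w∈S
      ... | inj₂ w∉S = (in∈ u∈S u∈ , i₁∈ , subst T (sym (joined-SC {nth i} {nth i₁} u∈S
              (trans (cong inS v₁≡) v₁∉S))) (Equivalence.from T-∧ (attached⁺ u~w w∉S ,
              subst (λ x → T (proj₂ x ≡ᵇ 1)) (sym nth-i₁) _))) ◅ ε

      to-i₁ : ∀ {i} → i ∈ T′ → Star (InducedEdge shrunk T′) i i₁
      to-i₁ {i} i∈ with side (proj₁ (nth i))
      ... | inj₁ i∈S with c , c∈ , c∉ ← anchor =
        from-S (proj₂ cvc _ c (in∈⁻ i∈S i∈) c∈) c∉ i refl i∈S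
      ... | inj₂ i∉S with proj₁ (nth i) ≟ proj₁ (nth i₁)
      ...   | yes eq with refl ← nth-injective i i₁ eq = ε
      ...   | no  ≢  = (i∈ , i₁∈ , clique-edge i i₁ i∉S (trans (cong inS v₁≡) v₁∉S) ≢) ◅ ε

      isCVC : IsConnectedVertexCover shrunk T′
      isCVC = covers , λ i j i∈ j∈ → to-i₁ i∈ ◅◅
        Star.reverse (λ {a} {b} (a∈ , b∈ , a~b) → b∈ , a∈ , subst T (G′.adj-sym a b) a~b)
          (to-i₁ j∈)

      private
        inner outer outer* : ℕ
        inner  = # (λ v → inS v ∧ lookup T* v) (allFin n)
        outer  = # (λ x → outS (proj₁ x) ∧ q (proj₁ x)) L
        outer* = # (λ v → outS v ∧ lookup T* v) (allFin n)

        ∣T′∣≡ : ∣ T′ ∣ ≡ inner + outer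
        ∣T′∣≡ = begin
          ∣ T′ ∣                                          ≡⟨ ∣tabulate-lookup∣ (q ∘ proj₁) L ⟩
          # (q ∘ proj₁) L                                 ≡⟨ #-split (inS ∘ proj₁) (q ∘ proj₁) L ⟩
          # (λ x → inS (proj₁ x) ∧ q (proj₁ x)) L + outer ≡⟨ cong (_+ outer) (#-L (λ v → inS v ∧ q v)
                                                             (λ v t → proj₁ (Equivalence.to T-∧ t))) ⟩
          # (λ v → inS v ∧ q v) (allFin n) + outer        ≡⟨ cong (_+ outer) (#-cong lemma (allFin n)) ⟩
          inner + outer                                   ∎
          where
          open ≡-Reasoning
          lemma : ∀ v → inS v ∧ q v ≡ inS v ∧ lookup T* v
          lemma v with inS v
          ... | true  = refl
          ... | false = refl

        outer<e : outer < e
        outer<e = subst (outer <_) (#outS-L e≤#C) (#-mono-<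
          (λ x t → proj₁ (Equivalence.to T-∧ t)) (subst (_∈ᴸ L) nth-i₂ (∈-lookup i₂))
          (Equivalence.from T-≡ (outS-true v₂∉S)) v₂-excluded)
          where
          v₂-excluded : outS v₂ ∧ q v₂ ≡ false
          v₂-excluded rewrite v₂∉S | dec-true (v₂ ≟ v₂) refl = refl

        #C≤ : #C ≤ suc outer*
        #C≤ = begin
          #C                     ≡⟨ #-split (lookup T*) outS (allFin n) ⟩
          # (λ v → lookup T* v ∧ outS v) (allFin n) + _
            ≤⟨ +-mono-≤ (≤-reflexive (#-cong (λ v → ∧-comm (lookup T* v) (outS v)) (allFin n)))
                 (#uncovered≤1 clique (proj₁ cvc)) ⟩
          outer* + 1             ≡⟨ +-comm outer* 1 ⟩
          suc outer*             ∎
          where open ≤-Reasoning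

      -- `T*` misses at most one clique vertex and `T′` misses `v₂`. The two omissions cancel, so
      -- this direction loses nothing.
      size-bound : ∣ T′ ∣ + #C ≤ ∣ T* ∣ + e
      size-bound = begin
        ∣ T′ ∣ + #C                 ≡⟨ cong (_+ #C) ∣T′∣≡ ⟩
        inner + outer + #C          ≤⟨ +-monoʳ-≤ (inner + outer) #C≤ ⟩
        inner + outer + suc outer*  ≡⟨ +-assoc inner outer (suc outer*) ⟩
        inner + (outer + suc outer*) ≡⟨ cong (λ z → inner + z) (trans (+-suc outer outer*) (+-comm (suc outer) outer*)) ⟩
        inner + (outer* + suc outer) ≡⟨ +-assoc inner outer* (suc outer) ⟨
        inner + outer* + suc outer  ≤⟨ +-monoʳ-≤ (inner + outer*) outer<e ⟩
        inner + outer* + e          ≡⟨ cong (_+ e) (#-split inS (lookup T*) (allFin n)) ⟨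
        # (lookup T*) (allFin n) + e ≡⟨ cong (_+ e) (∣∣≡#lookup T*) ⟨
        ∣ T* ∣ + e                  ∎
        where open ≤-Reasoning

    shrunk-complete : CompleteOutside shrunk shrunkS
    shrunk-complete i j i∉ j∉ i≢j = clique-edge i j (out i i∉) (out j j∉)
      (λ eq → i≢j (nth-injective i j eq))
      where
      out : ∀ i → i ∉ shrunkS → inS (proj₁ (nth i)) ≡ false
      out i i∉ with side (proj₁ (nth i))
      ... | inj₂ eq = eq
      ... | inj₁ eq = contradiction (∈-tabulate⁺ {f = inS ∘ proj₁ ∘ nth} (Equivalence.from T-≡ eq)) i∉

-- The WHILE programs and their runs

-- For runs of a closed length the bound is settled by evaluating `t ≤ᵇ b`.
fewer-steps : ∀ {n} {p : Cmd n} {σ σ′ t} b {_ : T (t ≤ᵇ b)} →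
  p , σ ⇓ σ′ within t → p , σ ⇓ σ′ ≤ b
fewer-steps {t = t} b {t≤b} r = t , r , ≤ᵇ⇒≤ t b t≤b

encodeList-map : {A B : Set} (⌜_⌝ : B → 𝔻) (f : A → B) → ∀ xs →
  encodeList ⌜_⌝ (map f xs) ≡ encodeList (⌜_⌝ ∘ f) xs
encodeList-map ⌜_⌝ f []       = refl
encodeList-map ⌜_⌝ f (x ∷ xs) = cong (⌜ f x ⌝ ∙_) (encodeList-map ⌜_⌝ f xs)

encodeList-cong : {A : Set} {f g : A → 𝔻} → (∀ x → f x ≡ g x) → ∀ xs →
  encodeList f xs ≡ encodeList g xs
encodeList-cong f≗g []       = refl
encodeList-cong f≗g (x ∷ xs) = cong₂ _∙_ (f≗g x) (encodeList-cong f≗g xs)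

module _ {A : Set} (p : A → Bool) {B : Set} (f : A → B) where

  push : List B → A → List B
  push acc x = if p x then f x ∷ acc else acc

  -- Consuming from the front and pushing reverses the list. The entries `ys` already treated
  -- generalise the accumulator for the induction.
  foldl-push : ∀ xs ys → foldl push (map f (filterᵇ p ys)) xs ≡ map f (filterᵇ p (xs ʳ++ ys))
  foldl-push []       ys = refl
  foldl-push (x ∷ xs) ys = trans (cong (λ acc → foldl push acc xs) lemma) (foldl-push xs (x ∷ ys))
    where
    lemma : push (map f (filterᵇ p ys)) x ≡ map f (filterᵇ p (x ∷ ys))
    lemma with p x
    ... | true  = refl
    ... | false = refl

foldl-∨ : {A : Set} (p : A → Bool) → ∀ b xs → foldl (λ b x → b ∨ p x) b xs ≡ b ∨ any p xs
foldl-∨ p b []       = sym (∨-identityʳ b)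
foldl-∨ p b (x ∷ xs) = trans (foldl-∨ p (b ∨ p x) xs) (∨-assoc b (p x) (any p xs))

yes𝔻 : 𝔻
yes𝔻 = encodeBool true

Variable : Set
Variable = Fin 13

vIn vRows vMask vParam vClock vCount vItems vBit vRow vCol vAll vGraph vSol : Variable
vIn    = Fin.# 0
vRows  = Fin.# 1
vMask  = Fin.# 2
vParam = Fin.# 3
vClock = Fin.# 4
vCount = Fin.# 5
vItems = Fin.# 6
vBit   = Fin.# 7
vRow   = Fin.# 8
vCol   = Fin.# 9
vAll   = Fin.# 10
vGraph = Fin.# 11
vSol   = Fin.# 12

skip : Cmd 13
skip = vBit ≔ var vBit

pop : Variable → Cmd 13
pop x = x ≔ tl (var x)

-- A countdown that carries a mark on its last entry, so that its head decides c ≡ᵇ 1.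
clock : ℕ → 𝔻
clock 0             = nil
clock 1             = yes𝔻 ∙ nil
clock (suc (suc c)) = nil ∙ clock (suc c)

-- One pass over the rows of the adjacency matrix.  vParam, initially suc k, is
-- decremented at the members of S and vClock, initially clock e, at the other
-- vertices; at the end vParam is nil iff |S| > k and vClock is nil iff at least
-- e vertices lie outside S.
neighbourBody scanBody : Cmd 13
neighbourBody =
  cond (hd (var vCol)) skip (cond (hd (var vRow)) (vBit ≔ quot yes𝔻) skip) ⨾
  pop vRow ⨾ pop vCol

-- An item is the `S`-bit, a flag that is `nil` iff the vertex is dropped, and the port bit. For a
-- clique vertex the clock itself is the flag and its head the port bit; for a member of `S` the
-- port bit is the `attached` bit just computed.
recordItem : Cmd 13
recordItem = cond (hd (var vMask))
  (vItems ≔ cons (cons (quot yes𝔻) (cons (quot yes𝔻) (var vBit))) (var vItems) ⨾ pop vParam)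
  (vItems ≔ cons (cons (quot nil) (cons (var vClock) (hd (var vClock)))) (var vItems) ⨾ pop vClock)

scanBody =
  vRow ≔ hd (var vRows) ⨾ vCol ≔ tl (hd (var vIn)) ⨾
  loop (var vRow) neighbourBody ⨾
  recordItem ⨾
  vBit ≔ quot nil ⨾ vCount ≔ cons (quot nil) (var vCount) ⨾ pop vRows ⨾ pop vMask

scan : ℕ → Cmd 13 → Cmd 13
scan e p =
  vRows ≔ hd (hd (var vIn)) ⨾ vMask ≔ tl (hd (var vIn)) ⨾
  -- A quoted constant costs one step whatever its size, so `e` does not enter the running time.
  vParam ≔ cons (quot nil) (tl (var vIn)) ⨾ vClock ≔ quot (clock e) ⨾
  loop (var vRows) scanBody ⨾ p

-- The matrix is read a second time: a new entry may depend on the port bits of two items, which are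
-- all known only after the first pass.
plainBit crossBit pushBit columnBody rowBody build : Cmd 13
plainBit = vBit ≔ cons (hd (var vRow)) (var vBit)
crossBit = cond (tl (tl (hd (var vItems))))
  (vBit ≔ cons (tl (tl (hd (var vCol)))) (var vBit))
  (vBit ≔ cons (quot nil) (var vBit))
pushBit = cond (hd (hd (var vItems)))
  (cond (hd (hd (var vCol))) plainBit crossBit)
  (cond (hd (hd (var vCol))) crossBit plainBit)
columnBody = cond (hd (tl (hd (var vCol)))) pushBit skip ⨾ pop vRow ⨾ pop vCol
rowBody =
  cond (hd (tl (hd (var vItems))))
    (vRow ≔ hd (var vRows) ⨾ vCol ≔ var vAll ⨾
     loop (var vRow) columnBody ⨾
     vGraph ≔ cons (var vBit) (var vGraph) ⨾ vBit ≔ quot nil ⨾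
     vMask ≔ cons (hd (hd (var vItems))) (var vMask) ⨾
     vCount ≔ cons (quot nil) (var vCount))
    skip ⨾
  pop vItems ⨾ pop vRows
build =
  loop (var vItems) (vAll ≔ cons (hd (var vItems)) (var vAll) ⨾ pop vItems) ⨾
  vItems ≔ var vAll ⨾ vRows ≔ hd (hd (var vIn)) ⨾ vCount ≔ quot nil ⨾
  loop (var vRows) rowBody ⨾
  vIn ≔ cons (cons (var vGraph) (var vMask)) (var vCount)

-- The empty graph, its empty deletion set and the parameter 0.
emptyCode : 𝔻
emptyCode = (nil ∙ nil) ∙ nil

reduceBody : ℕ → Cmd 13
reduceBody e = scan e (cond (var vParam)
  (cond (var vClock) (vIn ≔ cons (hd (var vIn)) (var vCount)) build)
  (vIn ≔ quot emptyCode))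

-- The items come in the order of `scanned`, so `vSol`, in the order of `L`, advances exactly at the
-- kept ones, and pushing the bits restores the vertex order of `G`. Bits of `T′` at clique vertices
-- are passed over and replaced by true.
mergeBody merge : Cmd 13
mergeBody =
  cond (hd (tl (hd (var vItems))))
    (cond (hd (hd (var vItems)))
      (vBit ≔ cons (hd (var vSol)) (var vBit))
      (vBit ≔ cons (quot yes𝔻) (var vBit)) ⨾
     pop vSol)
    (vBit ≔ cons (quot yes𝔻) (var vBit)) ⨾
  pop vItems
merge = loop (var vItems) mergeBody ⨾ vIn ≔ var vBit

-- The scan is repeated on the original instance. It reproduces the items and the case that the
-- reduction was in, so the reduced instance in the input is skipped.
liftBody : ℕ → Cmd 13
liftBody e =
  vSol ≔ tl (tl (var vIn)) ⨾ vIn ≔ hd (var vIn) ⨾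
  scan e (cond (var vParam)
    (cond (var vClock) (vIn ≔ var vSol) merge)
    (vIn ≔ tl (hd (var vIn))))

neighbour-runs : ∀ b a s {x r k c m j i g t ra rc rm} →
  neighbourBody ,
    x ∷ r ∷ rm ∷ k ∷ c ∷ m ∷ j ∷ encodeBool b ∷ (encodeBool a ∙ ra) ∷ (encodeBool s ∙ rc) ∷ i ∷ g ∷ t ∷ [] ⇓
    x ∷ r ∷ rm ∷ k ∷ c ∷ m ∷ j ∷ encodeBool (b ∨ (a ∧ not s)) ∷ ra ∷ rc ∷ i ∷ g ∷ t ∷ [] ≤ 14
neighbour-runs false false true  = fewer-steps 14 (seq (if-true (λ ()) assign) (seq assign assign))
neighbour-runs false true  true  = fewer-steps 14 (seq (if-true (λ ()) assign) (seq assign assign))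
neighbour-runs true  false true  = fewer-steps 14 (seq (if-true (λ ()) assign) (seq assign assign))
neighbour-runs true  true  true  = fewer-steps 14 (seq (if-true (λ ()) assign) (seq assign assign))
neighbour-runs false false false =
  fewer-steps 14 (seq (if-false refl (if-false refl assign)) (seq assign assign))
neighbour-runs true  false false =
  fewer-steps 14 (seq (if-false refl (if-false refl assign)) (seq assign assign))
neighbour-runs false true  false =
  fewer-steps 14 (seq (if-false refl (if-true (λ ()) assign)) (seq assign assign))
neighbour-runs true  true  false =
  fewer-steps 14 (seq (if-false refl (if-true (λ ()) assign)) (seq assign assign))

keepCode : Bool → ℕ → 𝔻
keepCode true  c = yes𝔻
keepCode false c = clock c

keepCode-view : ∀ s c →
  (keepCode s c ≢ nil × s ∨ not (c ≡ᵇ 0) ≡ true) ⊎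
  (keepCode s c ≡ nil × s ∨ not (c ≡ᵇ 0) ≡ false)
keepCode-view true  c             = inj₁ ((λ ()) , refl)
keepCode-view false 0             = inj₂ (refl , refl)
keepCode-view false 1             = inj₁ ((λ ()) , refl)
keepCode-view false (suc (suc c)) = inj₁ ((λ ()) , refl)

itemCode : Bool → ℕ → Bool → 𝔻
itemCode s c d = encodeBool s ∙ keepCode s c ∙ encodeBool (if s then d else c ≡ᵇ 1)

record-runs : ∀ s k c d {x r m j ra rc rm i g t} →
  recordItem ,
    x ∷ r ∷ (encodeBool s ∙ rm) ∷ encodeℕ k ∷ clock c ∷ m ∷ j ∷ encodeBool d ∷ ra ∷ rc ∷ i ∷ g ∷ t ∷ [] ⇓
    x ∷ r ∷ (encodeBool s ∙ rm) ∷ encodeℕ (predIf s k) ∷ clock (predIf (not s) c) ∷ m ∷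
      (itemCode s c d ∙ j) ∷ encodeBool d ∷ ra ∷ rc ∷ i ∷ g ∷ t ∷ [] ≤ 15
record-runs true  zero    c             d = fewer-steps 15 (if-true (λ ()) (seq assign assign))
record-runs true  (suc k) c             d = fewer-steps 15 (if-true (λ ()) (seq assign assign))
record-runs false k       0             d = fewer-steps 15 (if-false refl (seq assign assign))
record-runs false k       1             d = fewer-steps 15 (if-false refl (seq assign assign))
record-runs false k       (suc (suc c)) d = fewer-steps 15 (if-false refl (seq assign assign))

push-runs : ∀ sx px sy py a {x r rm k c m mx js b ra my rc i g t} →
  pushBit ,
    x ∷ r ∷ rm ∷ k ∷ c ∷ m ∷ ((encodeBool sx ∙ mx ∙ encodeBool px) ∙ js) ∷ b ∷ (encodeBool a ∙ ra) ∷
      ((encodeBool sy ∙ my ∙ encodeBool py) ∙ rc) ∷ i ∷ g ∷ t ∷ [] ⇓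
    x ∷ r ∷ rm ∷ k ∷ c ∷ m ∷ ((encodeBool sx ∙ mx ∙ encodeBool px) ∙ js) ∷
      (encodeBool (if sx xor sy then px ∧ py else a) ∙ b) ∷ (encodeBool a ∙ ra) ∷
      ((encodeBool sy ∙ my ∙ encodeBool py) ∙ rc) ∷ i ∷ g ∷ t ∷ [] ≤ 20
push-runs true  px    true  py a = fewer-steps 20 (if-true (λ ()) (if-true (λ ()) assign))
push-runs true  true  false py a =
  fewer-steps 20 (if-true (λ ()) (if-false refl (if-true (λ ()) assign)))
push-runs true  false false py a =
  fewer-steps 20 (if-true (λ ()) (if-false refl (if-false refl assign)))
push-runs false px    false py a = fewer-steps 20 (if-false refl (if-false refl assign))
push-runs false true  true  py a =
  fewer-steps 20 (if-false refl (if-true (λ ()) (if-true (λ ()) assign)))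
push-runs false false true  py a =
  fewer-steps 20 (if-false refl (if-true (λ ()) (if-false refl assign)))

-- Stores and step counts of the programs on an instance

module Runtime (G : Graph) (S : Subset (Graph.order G)) (e : ℕ) where
  open Graph G renaming (order to n)
  open Shrink G S e

  n′ : ℕ
  n′ = length (allFin n)

  maskCode : List (Fin n) → 𝔻
  maskCode = encodeList (encodeBool ∘ inS)

  rowsCode : List (Fin n) → 𝔻
  rowsCode = encodeList λ v → encodeList (encodeBool ∘ adj v) (allFin n)

  code : Item → 𝔻
  code (v , c) = itemCode (inS v) c (attached v)

  neighbours-run : ∀ v {x r rm k c m j i g t} →
    loop (var vRow) neighbourBody ,
      x ∷ r ∷ rm ∷ k ∷ c ∷ m ∷ j ∷ nil ∷ encodeList (encodeBool ∘ adj v) (allFin n) ∷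
        maskCode (allFin n) ∷ i ∷ g ∷ t ∷ [] ⇓
      x ∷ r ∷ rm ∷ k ∷ c ∷ m ∷ j ∷ encodeBool (attached v) ∷ nil ∷ nil ∷ i ∷ g ∷ t ∷ []
      ≤ 2 + n′ * 16
  neighbours-run v {x} {r} {rm} {k} {c} {m} {j} {i} {g} {t} =
    subst (λ b → loop (var vRow) neighbourBody , σ (allFin n) false ⇓ σ [] b ≤ 2 + n′ * 16)
      (foldl-∨ (λ w → adj v w ∧ outS w) false (allFin n))
      (loop-foldl σ (λ b w → b ∨ (adj v w ∧ outS w)) 14 (λ _ → refl) (λ _ _ _ ())
        (λ w ws b → neighbour-runs b (adj v w) (inS w)) (allFin n) false)
    where
    σ : List (Fin n) → Bool → Store 13
    σ ws b = x ∷ r ∷ rm ∷ k ∷ c ∷ m ∷ j ∷ encodeBool b ∷ encodeList (encodeBool ∘ adj v) ws ∷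
      maskCode ws ∷ i ∷ g ∷ t ∷ []

  -- What remains of the parameter, how many clique vertices may still be kept, the number of
  -- vertices read, and the items, latest first.
  ScanState : Set
  ScanState = ℕ × ℕ × ℕ × List Item

  scanStep : ScanState → Fin n → ScanState
  scanStep (k , c , m , j) v =
    predIf (inS v) k , predIf (outS v) c , suc m , (v , c) ∷ j

  foldl-scanStep : ∀ vs k c m j → foldl scanStep (k , c , m , j) vs ≡
    (k ∸ # inS vs , c ∸ # outS vs , length vs + m , mark c vs ʳ++ j)
  foldl-scanStep []       k c m j = refl
  foldl-scanStep (v ∷ vs) k c m j
    rewrite foldl-scanStep vs (predIf (inS v) k) (predIf (outS v) c) (suc m) ((v , c) ∷ j)
          | predIf-∸ inS v vs k | predIf-∸ outS v vs c | +-suc (length vs) m = refl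

  scanBodyTime scanTime : ℕ
  scanBodyTime = 3 + (4 + (2 + n′ * 16 + (15 + (2 + (4 + (3 + 3))))))
  scanTime     = 2 + n′ * (2 + scanBodyTime)

  scanned-store : 𝔻 → ℕ → ℕ → 𝔻 → Store 13
  scanned-store x k c t =
    x ∷ nil ∷ nil ∷ encodeℕ k ∷ clock c ∷ encodeℕ n′ ∷
      encodeList code scanned ∷ nil ∷ nil ∷ nil ∷ nil ∷ nil ∷ t ∷ []

  -- The rest of the program is a continuation. It starts from a store that shows the two
  -- differences deciding the case; `t`, the content of `vSol`, passes through untouched.
  scan-run : ∀ {p σ} k t {b} → let x = (rowsCode (allFin n) ∙ maskCode (allFin n)) ∙ encodeℕ k in
    p , scanned-store x (suc k ∸ #S) (e ∸ #C) t ⇓ σ ≤ b →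
    scan e p ,
      x ∷ nil ∷ nil ∷ nil ∷ nil ∷ nil ∷ nil ∷ nil ∷ nil ∷ nil ∷ nil ∷ nil ∷ t ∷ [] ⇓ σ
      ≤ 4 + (4 + (5 + (2 + (scanTime + b))))
  scan-run {p} {σ′} k t rest =
    exactly assign then exactly assign then exactly assign then exactly assign then
    subst (λ s → loop (var vRows) scanBody , σ (allFin n) (suc k , e , 0 , []) ⇓ σ [] s ≤ scanTime)
      (trans (foldl-scanStep (allFin n) (suc k) e 0 [])
        (cong (λ z → suc k ∸ #S , e ∸ #C , z , scanned) (+-identityʳ n′)))
      (loop-foldl σ scanStep scanBodyTime (λ _ → refl) (λ _ _ _ ()) body (allFin n) (suc k , e , 0 , []))
    then rest
    where
    σ : List (Fin n) → ScanState → Store 13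
    σ vs (k′ , c , m , j) =
      ((rowsCode (allFin n) ∙ maskCode (allFin n)) ∙ encodeℕ k) ∷ rowsCode vs ∷ maskCode vs ∷
        encodeℕ k′ ∷ clock c ∷ encodeℕ m ∷ encodeList code j ∷ nil ∷ nil ∷ nil ∷ nil ∷ nil ∷ t ∷ []
    body : ∀ v vs s → scanBody , σ (v ∷ vs) s ⇓ σ vs (scanStep s v) ≤ scanBodyTime
    body v vs (k′ , c , m , j) =
      exactly assign then exactly assign then neighbours-run v then
      record-runs (inS v) k′ c (attached v) then
      exactly assign then exactly assign then exactly assign then exactly assign

  keep-view : ∀ x →
    (keepCode (inS (proj₁ x)) (proj₂ x) ≢ nil × kept x ≡ true) ⊎
    (keepCode (inS (proj₁ x)) (proj₂ x) ≡ nil × kept x ≡ false)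
  keep-view (v , c) = keepCode-view (inS v) c

  markedRow joinedRow : Item → 𝔻
  markedRow x = encodeList (λ y → encodeBool (adj (proj₁ x) (proj₁ y))) marked
  joinedRow x = encodeList (encodeBool ∘ joined x) L

  -- Re-indexes rows and columns by items, so that a single list drives each loop of the second pass
  -- and the parallel codes are read in step.
  encode-marked : {B : Fin n → 𝔻} → encodeList B (allFin n) ≡ encodeList (B ∘ proj₁) marked
  encode-marked {B} = trans (cong (encodeList B) (sym (map-proj₁-mark e (allFin n))))
    (encodeList-map B proj₁ marked)

  rowsCode≡ : rowsCode (allFin n) ≡ encodeList markedRow marked
  rowsCode≡ = trans encode-marked (encodeList-cong (λ x → encode-marked) marked)

  ℓ : ℕ
  ℓ = length marked

  columns-run : ∀ x {inp r rm k c m js i g t} →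
    loop (var vRow) columnBody ,
      inp ∷ r ∷ rm ∷ k ∷ c ∷ m ∷ (code x ∙ js) ∷ nil ∷ markedRow x ∷ encodeList code marked ∷ i ∷ g ∷ t ∷ [] ⇓
      inp ∷ r ∷ rm ∷ k ∷ c ∷ m ∷ (code x ∙ js) ∷ joinedRow x ∷ nil ∷ nil ∷ i ∷ g ∷ t ∷ []
      ≤ 2 + ℓ * (2 + 31)
  columns-run x {inp} {r} {rm} {k} {c} {m} {js} {i} {g} {t} =
    subst (λ b → loop (var vRow) columnBody , σ marked [] ⇓
        inp ∷ r ∷ rm ∷ k ∷ c ∷ m ∷ (code x ∙ js) ∷ b ∷ nil ∷ nil ∷ i ∷ g ∷ t ∷ [] ≤ 2 + ℓ * (2 + 31))
      (trans (cong (encodeList encodeBool) (foldl-push kept (joined x) marked []))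
        (encodeList-map encodeBool (joined x) L))
      (loop-foldl σ (push kept (joined x)) 31 (λ _ → refl) (λ _ _ _ ()) body marked [])
    where
    σ : List Item → List Bool → Store 13
    σ ys b = inp ∷ r ∷ rm ∷ k ∷ c ∷ m ∷ (code x ∙ js) ∷ encodeList encodeBool b ∷
      encodeList (λ y → encodeBool (adj (proj₁ x) (proj₁ y))) ys ∷ encodeList code ys ∷ i ∷ g ∷ t ∷ []
    body : ∀ y ys b → columnBody , σ (y ∷ ys) b ⇓ σ ys (push kept (joined x) b y) ≤ 31
    body y ys b with keep-view y
    ... | inj₁ (k≢ , eq) rewrite eq =
      weaken (≤ᵇ⇒≤ _ 31 _) (if-true≤ k≢ (push-runs (inS (proj₁ x)) (port x) (inS (proj₁ y)) (port y)
        (adj (proj₁ x) (proj₁ y))) then exactly assign then exactly assign)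
    ... | inj₂ (k≡ , eq) rewrite eq =
      weaken (≤ᵇ⇒≤ _ 31 _) (if-false≤ k≡ (exactly assign) then exactly assign then exactly assign)

  rowTime rowsTime buildTime : ℕ
  rowTime   = 5 + (3 + (2 + (2 + ℓ * (2 + 31) + (4 + (2 + (6 + 4)))))) + (3 + 3)
  rowsTime  = 2 + ℓ * (2 + rowTime)
  buildTime = (2 + length scanned * (2 + (5 + 3))) + (2 + (4 + (2 + (rowsTime + 6))))

  shrunkCode : 𝔻
  shrunkCode = (encodeList joinedRow L ∙ encodeList (encodeBool ∘ inS ∘ proj₁) L) ∙ encodeℕ (length L)

  rows-run : ∀ {inp k c t} →
    loop (var vRows) rowBody ,
      inp ∷ rowsCode (allFin n) ∷ nil ∷ k ∷ c ∷ nil ∷ encodeList code marked ∷ nil ∷ nil ∷ nil ∷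
        encodeList code marked ∷ nil ∷ t ∷ [] ⇓
      inp ∷ nil ∷ encodeList (encodeBool ∘ inS ∘ proj₁) L ∷ k ∷ c ∷ encodeℕ (length L) ∷ nil ∷ nil ∷ nil ∷ nil ∷
        encodeList code marked ∷ encodeList joinedRow L ∷ t ∷ []
      ≤ rowsTime
  rows-run {inp} {k} {c} {t} =
    subst₂ (λ r xs → loop (var vRows) rowBody , start r ⇓ σ [] xs ≤ rowsTime)
      (sym rowsCode≡) (trans (foldl-push kept id marked []) (map-id L))
      (loop-foldl σ (push kept id) rowTime (λ _ → refl) (λ _ _ _ ()) body marked [])
    where
    start : 𝔻 → Store 13
    start r = inp ∷ r ∷ nil ∷ k ∷ c ∷ nil ∷ encodeList code marked ∷ nil ∷ nil ∷ nil ∷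
      encodeList code marked ∷ nil ∷ t ∷ []
    σ : List Item → List Item → Store 13
    σ xs acc = inp ∷ encodeList markedRow xs ∷ encodeList (encodeBool ∘ inS ∘ proj₁) acc ∷ k ∷ c ∷
      encodeℕ (length acc) ∷ encodeList code xs ∷ nil ∷ nil ∷ nil ∷
      encodeList code marked ∷ encodeList joinedRow acc ∷ t ∷ []
    body : ∀ x xs acc → rowBody , σ (x ∷ xs) acc ⇓ σ xs (push kept id acc x) ≤ rowTime
    body x xs acc with keep-view x
    ... | inj₁ (k≢ , eq) rewrite eq =
      if-true≤ k≢ (exactly assign then exactly assign then columns-run x then
        exactly assign then exactly assign then exactly assign then exactly assign)
        then exactly assign then exactly assign
    ... | inj₂ (k≡ , eq) rewrite eq =
      weaken (+-monoˡ-≤ 6 (m≤m+n 7 (5 + (ℓ * 33 + 16)))) (if-false≤ k≡ (exactly assign) then exactly assign then exactly assign)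

  reverse-run : ∀ {inp r rm k c m b row col g t} →
    loop (var vItems) (vAll ≔ cons (hd (var vItems)) (var vAll) ⨾ pop vItems) ,
      inp ∷ r ∷ rm ∷ k ∷ c ∷ m ∷ encodeList code scanned ∷ b ∷ row ∷ col ∷ nil ∷ g ∷ t ∷ [] ⇓
      inp ∷ r ∷ rm ∷ k ∷ c ∷ m ∷ nil ∷ b ∷ row ∷ col ∷ encodeList code marked ∷ g ∷ t ∷ []
      ≤ 2 + length scanned * (2 + (5 + 3))
  reverse-run {inp} {r} {rm} {k} {c} {m} {b} {row} {col} {g} {t} =
    subst (λ xs → loop (var vItems) (vAll ≔ cons (hd (var vItems)) (var vAll) ⨾ pop vItems) ,
        σ scanned [] ⇓ σ [] xs ≤ 2 + length scanned * (2 + (5 + 3)))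
      (reverse-involutive marked)
      (loop-foldl σ (flip _∷_) 8 (λ _ → refl) (λ _ _ _ ())
        (λ x xs acc → exactly assign then exactly assign) scanned [])
    where
    σ : List Item → List Item → Store 13
    σ xs acc = inp ∷ r ∷ rm ∷ k ∷ c ∷ m ∷ encodeList code xs ∷ b ∷ row ∷ col ∷ encodeList code acc ∷ g ∷ t ∷ []

  build-run : ∀ {kk k c m t} → ∃ λ σ →
    (build ,
      ((rowsCode (allFin n) ∙ maskCode (allFin n)) ∙ kk) ∷ nil ∷ nil ∷ k ∷ c ∷ m ∷
        encodeList code scanned ∷ nil ∷ nil ∷ nil ∷ nil ∷ nil ∷ t ∷ [] ⇓ σ ≤ buildTime) ×
    head σ ≡ shrunkCode
  build-run {kk} {k} {c} {m} {t} = _ ,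
    (reverse-run then exactly assign then exactly assign then exactly assign then
      rows-run then exactly assign) ,
    refl

  mergeTime : ℕ
  mergeTime = 2 + length scanned * (2 + 23) + 2

  merge-run : ∀ T′ {inp k c m} → ∃ λ σ →
    (merge ,
      inp ∷ nil ∷ nil ∷ k ∷ c ∷ m ∷ encodeList code scanned ∷ nil ∷ nil ∷ nil ∷ nil ∷ nil ∷
        encodeList (encodeBool ∘ restored T′ ∘ proj₁) L ∷ [] ⇓ σ ≤ mergeTime) ×
    head σ ≡ encodeSubset (extended T′)
  merge-run T′ {inp} {k} {c} {m} = _ ,
    (loop-foldl σ (λ acc x → result x ∷ acc) 23 (λ _ → refl) (λ _ _ _ ()) body scanned []
      then exactly assign) ,
    cong (encodeList encodeBool) final
    where
    result : Item → Bool
    result (v , _) = if inS v then restored T′ v else true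
    σ : List Item → List Bool → Store 13
    σ xs acc = inp ∷ nil ∷ nil ∷ k ∷ c ∷ m ∷ encodeList code xs ∷ encodeList encodeBool acc ∷
      nil ∷ nil ∷ nil ∷ nil ∷ encodeList (encodeBool ∘ restored T′ ∘ proj₁) (filterᵇ kept xs) ∷ []
    body : ∀ x xs acc → mergeBody , σ (x ∷ xs) acc ⇓ σ xs (result x ∷ acc) ≤ 23
    body x xs acc with keep-view x
    ... | inj₁ (k≢ , eq) rewrite eq with inS (proj₁ x)
    ...   | true  = weaken (≤ᵇ⇒≤ _ 23 _)
      (if-true≤ k≢ (if-true≤ (λ ()) (exactly assign) then exactly assign) then exactly assign)
    ...   | false = weaken (≤ᵇ⇒≤ _ 23 _)
      (if-true≤ k≢ (if-false≤ refl (exactly assign) then exactly assign) then exactly assign)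
    body x xs acc | inj₂ (k≡ , eq) rewrite eq with inS (proj₁ x)
    ...   | false = weaken (≤ᵇ⇒≤ _ 23 _)
      (if-false≤ k≡ (exactly assign) then exactly assign)
    ...   | true with () ← k≡
    final : foldl (λ acc x → result x ∷ acc) [] scanned ≡ toList (extended T′)
    final = begin
      foldl (λ acc x → result x ∷ acc) [] scanned  ≡⟨ reverse-foldl (λ acc x → result x ∷ acc) [] marked ⟩
      foldr (λ x acc → result x ∷ acc) [] marked   ≡⟨ map-is-foldr marked ⟨
      map result marked                            ≡⟨ map-∘ marked ⟩
      map f (map proj₁ marked)                     ≡⟨ cong (map f) (map-proj₁-mark e (allFin n)) ⟩
      map f (allFin n)                             ≡⟨ toList-tabulate f ⟨
      toList (extended T′)                         ∎
      where
      open ≡-Reasoning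
      f : Fin n → Bool
      f v = if inS v then restored T′ v else true

-- The approximation ratio

fromℕ : ℕ → ℚ
fromℕ n = ℤ.+ n / 1

-- `_/_` normalises by a gcd and does not compute on variables, hence the detour through
-- unnormalised rationals.
/1-+ : ∀ a b → (a ℤ.+ b) / 1 ≡ a / 1 ℚ.+ b / 1
/1-+ a b = ℚₚ.toℚᵘ-injective (begin
  ℚ.toℚᵘ ((a ℤ.+ b) / 1)                    ≈⟨ ℚₚ.toℚᵘ-fromℚᵘ (ℚᵘ.mkℚᵘ (a ℤ.+ b) 0) ⟩
  ℚᵘ.mkℚᵘ (a ℤ.+ b) 0                       ≈⟨ ℚᵘ.*≡* (cong (ℤ._* ℤ.+ 1) (cong₂ ℤ._+_ (ℤₚ.*-identityʳ a) (ℤₚ.*-identityʳ b))) ⟨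
  ℚᵘ.mkℚᵘ a 0 ℚᵘ.+ ℚᵘ.mkℚᵘ b 0              ≈⟨ ℚᵘₚ.+-cong (ℚₚ.toℚᵘ-fromℚᵘ (ℚᵘ.mkℚᵘ a 0)) (ℚₚ.toℚᵘ-fromℚᵘ (ℚᵘ.mkℚᵘ b 0)) ⟨
  ℚ.toℚᵘ (a / 1) ℚᵘ.+ ℚ.toℚᵘ (b / 1)        ≈⟨ ℚₚ.toℚᵘ-homo-+ (a / 1) (b / 1) ⟨
  ℚ.toℚᵘ (a / 1 ℚ.+ b / 1)                  ∎)
  where open import Relation.Binary.Reasoning.Setoid ℚᵘₚ.≃-setoid

/1-mono : ∀ {a b} → a ℤ.≤ b → a / 1 ℚ.≤ b / 1
/1-mono {a} {b} a≤b = ℚₚ.toℚᵘ-cancel-≤ (begin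
  ℚ.toℚᵘ (a / 1)   ≃⟨ ℚₚ.toℚᵘ-fromℚᵘ (ℚᵘ.mkℚᵘ a 0) ⟩
  ℚᵘ.mkℚᵘ a 0      ≤⟨ ℚᵘ.*≤* (ℤₚ.*-monoʳ-≤-nonNeg (ℤ.+ 1) a≤b) ⟩
  ℚᵘ.mkℚᵘ b 0      ≃⟨ ℚₚ.toℚᵘ-fromℚᵘ (ℚᵘ.mkℚᵘ b 0) ⟨
  ℚ.toℚᵘ (b / 1)   ∎)
  where open ℚᵘₚ.≤-Reasoning

fromℕ-+ : ∀ m n → fromℕ (m + n) ≡ fromℕ m ℚ.+ fromℕ n
fromℕ-+ m n = trans (cong (_/ 1) (ℤₚ.pos-+ m n)) (/1-+ (ℤ.+ m) (ℤ.+ n))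

fromℕ-mono : ∀ {m n} → m ≤ n → fromℕ m ℚ.≤ fromℕ n
fromℕ-mono m≤n = /1-mono (ℤ.+≤+ m≤n)

-- The ceiling is the negated floor of `ℚ.- p`, so this is the inequality of integer division for
-- `ℚ.- p` with its sign reversed.
p≤⌈p⌉ : ∀ p → p ℚ.≤ ceiling p / 1
p≤⌈p⌉ p@record{} = ℚₚ.toℚᵘ-cancel-≤ (begin
  ℚ.toℚᵘ p                  ≤⟨ ℚᵘ.*≤* lemma ⟩
  ℚᵘ.mkℚᵘ (ceiling p) 0     ≃⟨ ℚₚ.toℚᵘ-fromℚᵘ (ℚᵘ.mkℚᵘ (ceiling p) 0) ⟨
  ℚ.toℚᵘ (ceiling p / 1)    ∎)
  where
  lemma : ℚ.↥ p ℤ.* ℤ.+ 1 ℤ.≤ ceiling p ℤ.* ℚ.↧ p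
  lemma = subst₂ ℤ._≤_ (sym (ℤₚ.*-identityʳ (ℚ.↥ p)))
    (ℤₚ.neg-distribˡ-* (ℚ.floor (ℚ.- p)) (ℚ.↧ p))
    (subst (ℤ._≤ ℤ.- (ℚ.floor (ℚ.- p) ℤ.* ℚ.↧ p))
      (trans (cong ℤ.-_ (ℚₚ.↥-neg p)) (ℤₚ.neg-involutive (ℚ.↥ p)))
      (ℤₚ.neg-mono-≤ (subst (λ d → ℚ.floor (ℚ.- p) ℤ.* d ℤ.≤ ℚ.↥ (ℚ.- p)) (ℚₚ.↧-neg p)
        (floor* (ℚ.- p)))))
    where
    floor* : ∀ q → ℚ.floor q ℤ.* ℚ.↧ q ℤ.≤ ℚ.↥ q
    floor* q@record{} = [n/d]*d≤n (ℚ.↥ q) (ℚ.↧ q)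
  open ℚᵘₚ.≤-Reasoning

module Ratio (α : ℚ) (1<α : 1ℚ ℚ.< α) where

  β : ℚ
  β = α ℚ.- 1ℚ

  instance
    β≢0 : ℚ.NonZero β
    β≢0 = 1<α⇒α-1≢0 1<α

  bound : ℤ
  bound = ceiling (((ℤ.+ 2 / 1) ℚ.* α ℚ.- 1ℚ) ÷ β)

  cliqueSize : ℕ
  cliqueSize = ℤ.∣ bound ∣

  α≡1+β : α ≡ 1ℚ ℚ.+ β
  α≡1+β = solve 1 (λ a → a := con 1ℚ :+ (a :- con 1ℚ)) refl α
    where open ℚSolver.+-*-Solver

  β>0 : 0ℚ ℚ.< β
  β>0 = subst (ℚ._< β) (ℚₚ.+-inverseʳ 1ℚ) (ℚₚ.+-monoˡ-< (ℚ.- 1ℚ) 1<α)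

  private instance
    β-pos : ℚ.Positive β
    β-pos = ℚ.positive β>0

  -- With β = α - 1 the numerator 2α - 1 becomes 2β + 1; multiplying by β clears the fraction under
  -- the ceiling.
  2β+1≤bound*β : β ℚ.+ (β ℚ.+ 1ℚ) ℚ.≤ bound / 1 ℚ.* β
  2β+1≤bound*β = begin
    β ℚ.+ (β ℚ.+ 1ℚ)                            ≡⟨ solve 1 (λ a → (a :- con 1ℚ) :+ ((a :- con 1ℚ) :+ con 1ℚ)
                                                     := con (ℤ.+ 2 / 1) :* a :- con 1ℚ) refl α ⟩
    q                                           ≡⟨ ℚₚ.*-identityʳ q ⟨
    q ℚ.* 1ℚ                                    ≡⟨ cong (q ℚ.*_) (ℚₚ.*-inverseˡ β) ⟨
    q ℚ.* (ℚ.1/ β ℚ.* β)                        ≡⟨ ℚₚ.*-assoc q (ℚ.1/ β) β ⟨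
    (q ÷ β) ℚ.* β                               ≤⟨ ℚₚ.*-monoʳ-≤-nonNeg β {{ℚₚ.pos⇒nonNeg β}}
                                                     (p≤⌈p⌉ (q ÷ β)) ⟩
    bound / 1 ℚ.* β                             ∎
    where
    open ℚₚ.≤-Reasoning
    open ℚSolver.+-*-Solver
    q : ℚ
    q = (ℤ.+ 2 / 1) ℚ.* α ℚ.- 1ℚ

  1≤β+1 : 1ℚ ℚ.≤ β ℚ.+ 1ℚ
  1≤β+1 = subst (ℚ._≤ β ℚ.+ 1ℚ) (ℚₚ.+-identityˡ 1ℚ) (ℚₚ.+-monoˡ-≤ 1ℚ (ℚₚ.<⇒≤ β>0))

  0<2β+1 : 0ℚ ℚ.< β ℚ.+ (β ℚ.+ 1ℚ)
  0<2β+1 = ℚₚ.+-mono-<-≤ β>0 (ℚₚ.≤-trans (ℚₚ.nonNegative⁻¹ 1ℚ) 1≤β+1)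

  private
    -- The ceiling is a signed integer. Values up to 0 contradict `0<2β+1`; otherwise subtracting
    -- one β leaves 1 ≤ (z - 1)β, which also rules out z = 1.
    analyse : ∀ z → β ℚ.+ (β ℚ.+ 1ℚ) ℚ.≤ z / 1 ℚ.* β →
      ∃ λ d → ℤ.∣ z ∣ ≡ 2 + d × z ≡ ℤ.+ ℤ.∣ z ∣ × 1ℚ ℚ.≤ fromℕ (suc d) ℚ.* β
    analyse (ℤ.+ 0) le = contradiction (ℚₚ.<-≤-trans 0<2β+1 (subst (β ℚ.+ (β ℚ.+ 1ℚ) ℚ.≤_) (ℚₚ.*-zeroˡ β) le)) (ℚₚ.<-irrefl refl)
    analyse -[1+ n ] le = contradiction (ℚₚ.<-≤-trans 0<2β+1 (ℚₚ.≤-trans le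
      (ℚₚ.*-monoʳ-≤-nonNeg β {{ℚₚ.pos⇒nonNeg β}} (/1-mono { -[1+ n ]} {ℤ.+ 0} ℤ.-≤+))))
      (λ lt → ℚₚ.<-irrefl refl (subst (0ℚ ℚ.<_) (ℚₚ.*-zeroˡ β) lt))
    analyse (ℤ.+ suc m) le = lemma m le′
      where
      open ℚₚ.≤-Reasoning
      le′ : 1ℚ ℚ.≤ fromℕ m ℚ.* β
      le′ = ℚₚ.≤-trans 1≤β+1 (begin
        β ℚ.+ 1ℚ                                ≡⟨ solve 1 (λ b → b :+ con 1ℚ := (:- b) :+ (b :+ (b :+ con 1ℚ))) refl β ⟩
        ℚ.- β ℚ.+ (β ℚ.+ (β ℚ.+ 1ℚ))            ≤⟨ ℚₚ.+-monoʳ-≤ (ℚ.- β) le ⟩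
        ℚ.- β ℚ.+ fromℕ (suc m) ℚ.* β           ≡⟨ cong (λ z → ℚ.- β ℚ.+ z ℚ.* β) (fromℕ-+ 1 m) ⟩
        ℚ.- β ℚ.+ (1ℚ ℚ.+ fromℕ m) ℚ.* β        ≡⟨ solve 2 (λ b x → (:- b) :+ (con 1ℚ :+ x) :* b := x :* b) refl β (fromℕ m) ⟩
        fromℕ m ℚ.* β                           ∎)
        where open ℚSolver.+-*-Solver
      lemma : ∀ m → 1ℚ ℚ.≤ fromℕ m ℚ.* β → ∃ λ d → suc m ≡ 2 + d × ℤ.+ suc m ≡ ℤ.+ suc m × 1ℚ ℚ.≤ fromℕ (suc d) ℚ.* β
      lemma zero    le = contradiction
        (ℚₚ.<-≤-trans (ℚₚ.positive⁻¹ 1ℚ) (subst (1ℚ ℚ.≤_) (ℚₚ.*-zeroˡ β) le)) (ℚₚ.<-irrefl refl)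
      lemma (suc d) le = d , refl , refl , le

  cliqueSize-spec : ∃ λ d → cliqueSize ≡ 2 + d × bound ≡ ℤ.+ cliqueSize × 1ℚ ℚ.≤ fromℕ (suc d) ℚ.* β
  cliqueSize-spec = analyse bound 2β+1≤bound*β

  2≤cliqueSize : 2 ≤ cliqueSize
  2≤cliqueSize = subst (2 ≤_) (sym (proj₁ (proj₂ cliqueSize-spec))) (s≤s (s≤s z≤n))

  1≤α : 1ℚ ℚ.≤ α
  1≤α = ℚₚ.<⇒≤ 1<α

  -- With A the value of T′ and r the number of vertices removed from the
  -- clique: t ≤ A + 1 + r ≤ α A + r ≤ α c m + α c r ≤ α c o, where
  -- A + 1 ≤ α A because A ≥ cliqueSize - 1 ≥ 1 / (α - 1).
  ratio-bound : ∀ {c t A m o C} → 1ℚ ℚ.≤ c →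
    cliqueSize ≤ C → cliqueSize ≤ suc A →
    t + cliqueSize ≤ suc A + C → m + C ≤ o + cliqueSize →
    fromℕ A ℚ.≤ c ℚ.* fromℕ m → fromℕ t ℚ.≤ α ℚ.* c ℚ.* fromℕ o
  ratio-bound {c} {t} {A} {m} {o} {C} 1≤c e≤C e≤A t≤ m≤ A≤ = begin
    fromℕ t                                     ≤⟨ fromℕ-mono t≤′ ⟩
    fromℕ (suc A + r)                           ≡⟨ trans (fromℕ-+ (suc A) r) (cong (ℚ._+ fromℕ r) (fromℕ-+ 1 A)) ⟩
    1ℚ ℚ.+ fromℕ A ℚ.+ fromℕ r                  ≤⟨ ℚₚ.+-monoˡ-≤ (fromℕ r) (ℚₚ.+-monoˡ-≤ (fromℕ A) 1≤Aβ) ⟩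
    fromℕ A ℚ.* β ℚ.+ fromℕ A ℚ.+ fromℕ r       ≡⟨ solve 3 (λ x b y → x :* b :+ x :+ y := (con 1ℚ :+ b) :* x :+ y)
                                                     refl (fromℕ A) β (fromℕ r) ⟩
    (1ℚ ℚ.+ β) ℚ.* fromℕ A ℚ.+ fromℕ r          ≡⟨ cong (λ a → a ℚ.* fromℕ A ℚ.+ fromℕ r) α≡1+β ⟨
    α ℚ.* fromℕ A ℚ.+ fromℕ r                   ≤⟨ ℚₚ.+-mono-≤ (ℚₚ.*-monoˡ-≤-nonNeg α A≤) r≤ ⟩
    α ℚ.* (c ℚ.* fromℕ m) ℚ.+ α ℚ.* c ℚ.* fromℕ r
                                                ≡⟨ solve 4 (λ a c x y → a :* (c :* x) :+ a :* c :* y := a :* c :* (x :+ y))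
                                                     refl α c (fromℕ m) (fromℕ r) ⟩
    α ℚ.* c ℚ.* (fromℕ m ℚ.+ fromℕ r)           ≡⟨ cong (α ℚ.* c ℚ.*_) (fromℕ-+ m r) ⟨
    α ℚ.* c ℚ.* fromℕ (m + r)                   ≤⟨ ℚₚ.*-monoˡ-≤-nonNeg (α ℚ.* c) (fromℕ-mono m≤′) ⟩
    α ℚ.* c ℚ.* fromℕ o                         ∎
    where
    open ℚₚ.≤-Reasoning
    open ℚSolver.+-*-Solver
    eq = proj₁ (proj₂ cliqueSize-spec)
    1≤dβ = proj₂ (proj₂ (proj₂ cliqueSize-spec))
    e r : ℕ
    e = cliqueSize
    r = C ∸ e
    C≡ : r + e ≡ C
    C≡ = m∸n+n≡m e≤C
    t≤′ : t ≤ suc A + r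
    t≤′ = +-cancelʳ-≤ e t (suc A + r)
      (subst (t + e ≤_) (trans (cong (λ z → suc A + z) (sym C≡)) (sym (+-assoc (suc A) r e))) t≤)
    m≤′ : m + r ≤ o
    m≤′ = +-cancelʳ-≤ e (m + r) o
      (subst (_≤ o + e) (trans (cong (λ z → m + z) (sym C≡)) (sym (+-assoc m r e))) m≤)
    instance
      α≥0 : ℚ.NonNegative α
      α≥0 = ℚ.nonNegative (ℚₚ.≤-trans (ℚₚ.nonNegative⁻¹ 1ℚ) 1≤α)
      c≥0 : ℚ.NonNegative c
      c≥0 = ℚ.nonNegative (ℚₚ.≤-trans (ℚₚ.nonNegative⁻¹ 1ℚ) 1≤c)
      αc≥0 : ℚ.NonNegative (α ℚ.* c)
      αc≥0 = ℚₚ.nonNeg*nonNeg⇒nonNeg α c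
      r≥0 : ℚ.NonNegative (fromℕ r)
      r≥0 = ℚ.nonNegative (fromℕ-mono {0} {r} z≤n)
    1≤Aβ : 1ℚ ℚ.≤ fromℕ A ℚ.* β
    1≤Aβ = ℚₚ.≤-trans 1≤dβ (ℚₚ.*-monoʳ-≤-nonNeg β {{ℚₚ.pos⇒nonNeg β}}
      (fromℕ-mono (s≤s⁻¹ (subst (_≤ suc A) eq e≤A))))
    1≤αc : 1ℚ ℚ.≤ α ℚ.* c
    1≤αc = ℚₚ.≤-trans 1≤α (subst (ℚ._≤ α ℚ.* c) (ℚₚ.*-identityʳ α) (ℚₚ.*-monoˡ-≤-nonNeg α 1≤c))
    r≤ : fromℕ r ℚ.≤ α ℚ.* c ℚ.* fromℕ r
    r≤ = subst (ℚ._≤ α ℚ.* c ℚ.* fromℕ r) (ℚₚ.*-identityˡ (fromℕ r)) (ℚₚ.*-monoʳ-≤-nonNeg (fromℕ r) 1≤αc)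

-- Optimal values and approximate solutions

module ℕ± = AddExtrema {A = ℕ} _≤_
module ℚ± = AddExtrema {A = ℚ} ℚ._≤_

≤ℕ±-refl : ∀ o → o ≤ℕ± o
≤ℕ±-refl ⊥±    = ℕ±.⊥±≤⊥±
≤ℕ±-refl [ n ] = ℕ±.[ ≤-refl ]
≤ℕ±-refl ⊤±    = ℕ±.⊤±≤⊤±

-- `IsApprox` must exhibit the optimum of the original instance, which exists by search through the
-- finitely many subsets. The search belongs to the proof and not to the programs.
argmin : ∀ {n} (f : Subset n → ℕ ±) → ∃ λ T → ∀ T′ → f T ≤ℕ± f T′
argmin {zero}  f = [] , λ where [] → ≤ℕ±-refl (f [])
argmin {suc n} f
  with T₁ , min₁ ← argmin (λ T → f (true ∷ T)) | T₂ , min₂ ← argmin (λ T → f (false ∷ T))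
  with ℕ±.≤±-total ≤-total (f (true ∷ T₁)) (f (false ∷ T₂))
... | inj₁ le = true ∷ T₁ , λ where
  (true ∷ T)  → min₁ T
  (false ∷ T) → ℕ±.≤±-trans ≤-trans le (min₂ T)
... | inj₂ le = false ∷ T₂ , λ where
  (true ∷ T)  → ℕ±.≤±-trans ≤-trans le (min₁ T)
  (false ∷ T) → min₂ T

module Value (G : Graph) (S : Subset (Graph.order G)) where

  value : ℕ → Subset (Graph.order G) → ℕ ±
  value = valueCVC G S

  value-many : ∀ {k} → k < ∣ S ∣ → ∀ T → value k T ≡ ⊥±
  value-many {k} k< T rewrite dec-true (k <? ∣ S ∣) k< = refl

  value-incomplete : ∀ {k} → ¬ CompleteOutside G S → ∀ T → value k T ≡ ⊥±
  value-incomplete {k} ¬c T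
    rewrite dec-false (completeOutside? G S) ¬c | ∨-zeroʳ (does (k <? ∣ S ∣)) = refl

  module _ {k} (few : ∣ S ∣ ≤ k) (complete : CompleteOutside G S) where

    value-cvc : ∀ {T} → IsConnectedVertexCover G T → value k T ≡ [ ∣ T ∣ ]
    value-cvc {T} cvc
      rewrite dec-false (k <? ∣ S ∣) (≤⇒≯ few) | dec-true (completeOutside? G S) complete
            | dec-true (isConnectedVertexCover? G T) cvc = refl

    value-¬cvc : ∀ {T} → ¬ IsConnectedVertexCover G T → value k T ≡ ⊤±
    value-¬cvc {T} ¬cvc
      rewrite dec-false (k <? ∣ S ∣) (≤⇒≯ few) | dec-true (completeOutside? G S) complete
            | dec-false (isConnectedVertexCover? G T) ¬cvc = refl

    value-either : ∀ T → (IsConnectedVertexCover G T × value k T ≡ [ ∣ T ∣ ]) ⊎ value k T ≡ ⊤±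
    value-either T with isConnectedVertexCover? G T
    ... | yes cvc = inj₁ (cvc , value-cvc cvc)
    ... | no ¬cvc = inj₂ (value-¬cvc ¬cvc)

  -- The parameter enters a value only through the test against |S|. This is why the order of the
  -- graph can take the place of `k`.
  value-parameter : ∀ {k k′} → ∣ S ∣ ≤ k → ∣ S ∣ ≤ k′ → ∀ T → value k T ≡ value k′ T
  value-parameter {k} {k′} few few′ T
    rewrite dec-false (k <? ∣ S ∣) (≤⇒≯ few) | dec-false (k′ <? ∣ S ∣) (≤⇒≯ few′) = refl

  -- The case of a graph without a connected vertex cover, such as one with edges in two components:
  -- no value exceeds an infinite optimum.
  approx-⊤ : ∀ {c k T₀ T} → value k T₀ ≡ ⊤± → (∀ T → value k T₀ ≤ℕ± value k T) →
    IsApprox CVC c (G , S) k T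
  approx-⊤ {k = k} {T₀} {T} eq min = ⊤± ,
    ((T₀ , eq) , λ T′ → subst (_≤ℕ± value k T′) eq (min T′)) ,
    fromℕ± (value k T) ℚ±.≤⊤±

  approx-finite : ∀ {c k T₀ T m n} → value k T₀ ≡ [ m ] → (∀ T → value k T₀ ≤ℕ± value k T) →
    value k T ≡ [ n ] → fromℕ n ℚ.≤ c ℚ.* fromℕ m → IsApprox CVC c (G , S) k T
  approx-finite {c} {k} {T₀} {T} {m} eq min eqT le = [ m ] ,
    ((T₀ , eq) , λ T′ → subst (_≤ℕ± value k T′) eq (min T′)) ,
    subst (λ v → fromℕ± v ≤ℚ± scale c [ m ]) (sym eqT) ℚ±.[ le ]

  -- The cover `T₁` makes the optimum finite, so an approximate `T` cannot have value ∞ and must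
  -- itself be a connected vertex cover.
  approx-finite⁻ : ∀ {c k T T₁} → ∣ S ∣ ≤ k → CompleteOutside G S → IsConnectedVertexCover G T₁ →
    IsApprox CVC c (G , S) k T →
    IsConnectedVertexCover G T × ∃ λ m → m ≤ ∣ T₁ ∣ × fromℕ ∣ T ∣ ℚ.≤ c ℚ.* fromℕ m
  approx-finite⁻ {c} {k} {T} {T₁} few complete cvc₁ (o , ((T₀ , eq₀) , min) , le) =
    lemma (value-either few complete T₀) (value-either few complete T)
      (subst (o ≤ℕ±_) (value-cvc few complete cvc₁) (min T₁))
    where
    lemma : (IsConnectedVertexCover G T₀ × value k T₀ ≡ [ ∣ T₀ ∣ ]) ⊎ value k T₀ ≡ ⊤± →
      (IsConnectedVertexCover G T × value k T ≡ [ ∣ T ∣ ]) ⊎ value k T ≡ ⊤± →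
      o ≤ℕ± [ ∣ T₁ ∣ ] →
      IsConnectedVertexCover G T × ∃ λ m → m ≤ ∣ T₁ ∣ × fromℕ ∣ T ∣ ℚ.≤ c ℚ.* fromℕ m
    lemma (inj₂ eq) _ o≤ with () ← subst (_≤ℕ± [ ∣ T₁ ∣ ]) (trans (sym eq₀) eq) o≤
    lemma (inj₁ (_ , eq)) (inj₂ eqT) o≤
      with () ← subst₂ (λ v o → fromℕ± v ≤ℚ± scale c o) eqT (trans (sym eq₀) eq) le
    lemma (inj₁ (_ , eq)) (inj₁ (cvc , eqT)) o≤ = cvc , ∣ T₀ ∣ ,
      ℕ±.[≤]-injective (subst (_≤ℕ± [ ∣ T₁ ∣ ]) (trans (sym eq₀) eq) o≤) ,
      ℚ±.[≤]-injective (subst₂ (λ v o → fromℕ± v ≤ℚ± scale c o) eqT (trans (sym eq₀) eq) le)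

  approx-⊥ : ∀ {c k T} → (∀ T → value k T ≡ ⊥±) → IsApprox CVC c (G , S) k T
  approx-⊥ {c} {k} {T} all⊥ = ⊥± ,
    ((T , all⊥ T) , λ T′ → ℕ±.⊥±≤ value k T′) ,
    subst (λ v → fromℕ± v ≤ℚ± ⊥±) (sym (all⊥ T)) ℚ±.⊥±≤⊥±

scale-mono : ∀ {c c′} o → c ℚ.≤ c′ → scale c o ≤ℚ± scale c′ o
scale-mono ⊥±    c≤ = ℚ±.⊥±≤⊥±
scale-mono [ n ] c≤ = ℚ±.[ ℚₚ.*-monoʳ-≤-nonNeg (fromℕ n) {{ℚ.nonNegative (fromℕ-mono {0} {n} z≤n)}} c≤ ]
scale-mono ⊤±    c≤ = ℚ±.⊤±≤⊤±

-- The ratio of the lifted solution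

module Approx (α : ℚ) (1<α : 1ℚ ℚ.< α) (G : Graph) (S : Subset (Graph.order G))
              {c : ℚ} (1≤c : 1ℚ ℚ.≤ c) where
  open Ratio α 1<α
  open Shrink G S cliqueSize
  open Value G S
  module V′ = Value shrunk shrunkS

  c≤αc : c ℚ.≤ α ℚ.* c
  c≤αc = subst (ℚ._≤ α ℚ.* c) (ℚₚ.*-identityˡ c)
    (ℚₚ.*-monoʳ-≤-nonNeg c {{ℚ.nonNegative (ℚₚ.≤-trans (ℚₚ.nonNegative⁻¹ 1ℚ) 1≤c)}} 1≤α)

  small : ∀ {k k′ T} → ∣ S ∣ ≤ k → ∣ S ∣ ≤ k′ →
    IsApprox CVC c (G , S) k′ T → IsApprox CVC (α ℚ.* c) (G , S) k T
  small {k} {k′} {T} few few′ (o , ((T₀ , eq) , min) , le) =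
    o , ((T₀ , trans (same T₀) eq) , λ T′ → subst (o ≤ℕ±_) (sym (same T′)) (min T′)) ,
    ℚ±.≤±-trans ℚₚ.≤-trans (subst (λ v → fromℕ± v ≤ℚ± scale c o) (sym (same T)) le)
      (scale-mono o c≤αc)
    where same = value-parameter few few′

  -- If the optimum `T₀` of `G` is finite, its restriction is a cover of the shrunken graph. So the
  -- reduced optimum is finite too, and `T′` is a genuine cover that can be extended.
  large-valid : ∀ {k T′} → ∣ S ∣ ≤ k → cliqueSize ≤ #C → CompleteOutside G S →
    IsApprox CVC c (shrunk , shrunkS) (length L) T′ →
    IsApprox CVC (α ℚ.* c) (G , S) k (extended T′)
  large-valid {k} {T′} few e≤#C complete approx =
    lemma (argmin (value k)) (value-either few complete (proj₁ (argmin (value k))))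
    where
    open Correct G S cliqueSize
    open Large e≤#C 2≤cliqueSize complete
    lemma : ((T₀ , _) : ∃ λ T → ∀ T′ → value k T ≤ℕ± value k T′) →
      (IsConnectedVertexCover G T₀ × value k T₀ ≡ [ ∣ T₀ ∣ ]) ⊎ value k T₀ ≡ ⊤± →
      IsApprox CVC (α ℚ.* c) (G , S) k (extended T′)
    lemma (T₀ , min) (inj₂ eq)          = approx-⊤ eq min
    lemma (T₀ , min) (inj₁ (cvc₀ , eq)) = approx-finite eq min
      (value-cvc few complete E.isCVC)
      (ratio-bound 1≤c e≤#C E.e≤∣T′∣ E.size-bound
        (≤-trans (+-monoˡ-≤ #C (proj₁ (proj₂ (proj₂ found)))) R.size-bound)
        (proj₂ (proj₂ (proj₂ found))))
      where
      module R = Restrict {T₀} cvc₀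
      found = V′.approx-finite⁻ (∣p∣≤n shrunkS) shrunk-complete R.isCVC approx
      module E = Extend {T′} (proj₁ found)

  -- The programs do not test whether the graph outside `S` is complete. If it is not, every
  -- solution of the original instance has value -∞ and the lifted set is optimal.
  large : ∀ {k T′} → ∣ S ∣ ≤ k → cliqueSize ≤ #C →
    IsApprox CVC c (shrunk , shrunkS) (length L) T′ →
    IsApprox CVC (α ℚ.* c) (G , S) k (extended T′)
  large {k} {T′} few e≤#C approx = lemma (completeOutside? G S)
    where
    lemma : Dec (CompleteOutside G S) → IsApprox CVC (α ℚ.* c) (G , S) k (extended T′)
    lemma (no ¬complete) = approx-⊥ (value-incomplete ¬complete)
    lemma (yes complete) = large-valid few e≤#C complete approx

-- Sizes and running times

module Polynomial {z : ℕ} (1≤z : 1 ≤ z) where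

  1≤z^ : ∀ d → 1 ≤ z ^ d
  1≤z^ zero    = ≤-refl
  1≤z^ (suc d) = *-mono-≤ 1≤z (1≤z^ d)

  -- A record lets unification recover degree and coefficient; the combinators then follow the shape
  -- of a time expression.
  record Bounded (d a t : ℕ) : Set where
    constructor bounded
    field bound⁻ : t ≤ a * z ^ d

  open Bounded public

  infixr 6 _⊕_
  infixr 7 _⊗_

  const≤ : ∀ {d} a → Bounded d a a
  const≤ {d} a = bounded (subst (_≤ a * z ^ d) (*-identityʳ a) (*-monoʳ-≤ a (1≤z^ d)))

  _⊕_ : ∀ {d s t a b} → Bounded d a s → Bounded d b t → Bounded d (a + b) (s + t)
  _⊕_ {d} {a = a} {b} (bounded s≤) (bounded t≤) =
    bounded (≤-trans (+-mono-≤ s≤ t≤) (≤-reflexive (sym (*-distribʳ-+ (z ^ d) a b))))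

  _⊗_ : ∀ {d m t a} → m ≤ z → Bounded d a t → Bounded (suc d) a (m * t)
  _⊗_ {d} {a = a} m≤ (bounded t≤) = bounded (≤-trans (*-mono-≤ m≤ t≤) (≤-reflexive lemma))
    where
    lemma : z * (a * z ^ d) ≡ a * (z * z ^ d)
    lemma = trans (sym (*-assoc z a _)) (trans (cong (_* z ^ d) (*-comm z a)) (*-assoc a z _))

  _∙≤_ : ∀ {d s t a} → s ≤ t → Bounded d a t → Bounded d a s
  s≤t ∙≤ bounded t≤ = bounded (≤-trans s≤t t≤)

size-encodeList : {A : Set} (f : A → 𝔻) (b : ℕ) → (∀ x → size (f x) ≤ b) → ∀ xs →
  size (encodeList f xs) ≤ suc (length xs * suc b)
size-encodeList f b f≤ []       = ≤-refl
size-encodeList f b f≤ (x ∷ xs) = s≤s (≤-trans (+-mono-≤ (f≤ x) (size-encodeList f b f≤ xs))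
  (≤-reflexive (+-suc b (length xs * suc b))))

length≤size : {A : Set} (f : A → 𝔻) → ∀ xs → length xs ≤ size (encodeList f xs)
length≤size f []       = z≤n
length≤size f (x ∷ xs) = s≤s (≤-trans (length≤size f xs) (m≤n+m _ (size (f x))))

size-encodeBool : ∀ b → size (encodeBool b) ≤ 3
size-encodeBool false = s≤s z≤n
size-encodeBool true  = ≤-refl

size-encodeℕ : ∀ n → size (encodeℕ n) ≡ suc (n * 2)
size-encodeℕ zero    = refl
size-encodeℕ (suc n) = cong (λ m → 2 + m) (size-encodeℕ n)

length-allFin : ∀ n → length (allFin n) ≡ n
length-allFin n = length-tabulate {n = n} id

size-encodeSubset : ∀ {n} (S : Subset n) → size (encodeSubset S) ≤ suc (n * 4)
size-encodeSubset {n} S = subst (λ m → size (encodeSubset S) ≤ suc (m * 4)) (length-toList S)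
  (size-encodeList encodeBool 3 size-encodeBool (toList S))

encodeGraph≡ : ∀ G → let open Graph G in
  encodeGraph G ≡ encodeList (λ u → encodeList (encodeBool ∘ adj u) (allFin order)) (allFin order)
encodeGraph≡ G = begin
  encodeList (encodeList encodeBool) (toList (tabulate λ u → toList (tabulate (adj u))))
    ≡⟨ cong (encodeList (encodeList encodeBool)) (toList-tabulate (λ u → toList (tabulate (adj u)))) ⟩
  encodeList (encodeList encodeBool) (map (λ u → toList (tabulate (adj u))) (allFin order))
    ≡⟨ encodeList-map (encodeList encodeBool) (λ u → toList (tabulate (adj u))) (allFin order) ⟩
  encodeList (λ u → encodeList encodeBool (toList (tabulate (adj u)))) (allFin order)
    ≡⟨ encodeList-cong (λ u → trans (cong (encodeList encodeBool) (toList-tabulate (adj u)))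
         (encodeList-map encodeBool (adj u) (allFin order))) (allFin order) ⟩
  encodeList (λ u → encodeList (encodeBool ∘ adj u) (allFin order)) (allFin order) ∎
  where
  open ≡-Reasoning
  open Graph G

encodeSubset≡ : ∀ {n} (S : Subset n) → encodeSubset S ≡ encodeList (encodeBool ∘ lookup S) (allFin n)
encodeSubset≡ {n} S = trans (cong (encodeList encodeBool) (toList≡map-lookup S))
  (encodeList-map encodeBool (lookup S) (allFin n))

encodeList-lookup : {A : Set} (f : A → 𝔻) → ∀ xs →
  encodeList (f ∘ List.lookup xs) (allFin (length xs)) ≡ encodeList f xs
encodeList-lookup f xs = begin
  encodeList (f ∘ List.lookup xs) (allFin (length xs))          ≡⟨ encodeList-map f (List.lookup xs) (allFin (length xs)) ⟨
  encodeList f (map (List.lookup xs) (allFin (length xs)))      ≡⟨ cong (encodeList f) (map-lookup-allFin id xs) ⟩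
  encodeList f (map id xs)                                      ≡⟨ cong (encodeList f) (map-id xs) ⟩
  encodeList f xs                                               ∎
  where open ≡-Reasoning

-- A bit takes at most 3 nodes and its list cell one more, so the matrix has leading term 4n²; the
-- square with factor 5 absorbs the rest, including the unary parameter.
size-encode : ∀ G S → let n = Graph.order G in
  size (Problem.encode CVC (G , S) n) ≤ suc n * (suc n * 5)
size-encode G S = begin
  suc (suc (size (encodeGraph G) + size (encodeSubset S)) + size (encodeℕ n))
    ≤⟨ s≤s (+-mono-≤ (s≤s (+-mono-≤ graph≤ (size-encodeSubset S))) (≤-reflexive (size-encodeℕ n))) ⟩
  suc (suc (suc (n * suc (suc (n * 4))) + suc (n * 4)) + suc (n * 2))
    ≤⟨ m≤m+n _ (n * n + n * 2) ⟩
  suc (suc (suc (n * suc (suc (n * 4))) + suc (n * 4)) + suc (n * 2)) + (n * n + n * 2)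
    ≡⟨ expand n ⟩
  suc n * (suc n * 5) ∎
  where
  open Graph G renaming (order to n)
  open ≤-Reasoning
  expand : ∀ n → suc (suc (suc (n * suc (suc (n * 4))) + suc (n * 4)) + suc (n * 2)) + (n * n + n * 2)
    ≡ suc n * (suc n * 5)
  expand = ℕSolver.solve-∀
  graph≤ : size (encodeGraph G) ≤ suc (n * suc (suc (n * 4)))
  graph≤ = subst₂ (λ d m → size d ≤ suc (m * suc (suc (n * 4)))) (sym (encodeGraph≡ G)) (length-allFin n)
    (size-encodeList _ (suc (n * 4))
      (λ u → subst (λ m → size (encodeList (encodeBool ∘ adj u) (allFin n)) ≤ suc (m * 4)) (length-allFin n)
        (size-encodeList (encodeBool ∘ adj u) 3 (size-encodeBool ∘ adj u) (allFin n)))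
      (allFin n))

order≤size : ∀ G S → Graph.order G < size (Problem.encodeInstance CVC (G , S))
order≤size G S = s≤s (≤-trans (subst₂ (λ d m → m ≤ size d) (sym (encodeGraph≡ G)) (length-allFin _)
  (length≤size _ (allFin (Graph.order G)))) (m≤m+n _ _))

emptyGraph : Graph
emptyGraph = record { order = 0 ; adj = λ () ; adj-sym = λ () ; adj-irrefl = λ () }

-- sizeBody e computes m * (m * 5) for m = suc (e + k) by two nested loops.
addition : ℕ → Exp 4 → Exp 4
addition zero    a = a
addition (suc n) a = cons (quot nil) (addition n a)

v₀ v₁ v₂ v₃ : Fin 4
v₀ = Fin.# 0
v₁ = Fin.# 1
v₂ = Fin.# 2
v₃ = Fin.# 3

addFives multiply : Cmd 4
addFives = loop (var v₂) (v₃ ≔ addition 5 (var v₃) ⨾ v₂ ≔ tl (var v₂))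
multiply = loop (var v₀) (v₂ ≔ var v₁ ⨾ addFives ⨾ v₀ ≔ tl (var v₀))

sizeBody : ℕ → Cmd 4
sizeBody e = v₀ ≔ addition (suc e) (var v₀) ⨾ v₁ ≔ var v₀ ⨾ multiply ⨾ v₀ ≔ var v₃

eval-addition : ∀ m k (a : Exp 4) (σ : Store 4) → eval a σ ≡ encodeℕ k → eval (addition m a) σ ≡ encodeℕ (m + k)
eval-addition zero    k a σ eq = eq
eval-addition (suc m) k a σ eq = cong (nil ∙_) (eval-addition m k a σ eq)

-- Accumulating forms that unfold as the two loops do; closed forms are derived afterwards.
add5s : ℕ → ℕ → ℕ
add5s zero    w = w
add5s (suc z) w = add5s z (5 + w)

add5ss : ℕ → ℕ → ℕ → ℕ
add5ss zero    m w = w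
add5ss (suc o) m w = add5ss o m (add5s m w)

add5s≡ : ∀ z w → add5s z w ≡ z * 5 + w
add5s≡ zero    w = refl
add5s≡ (suc z) w = trans (add5s≡ z (5 + w)) (lemma z w)
  where
  lemma : ∀ z w → z * 5 + (5 + w) ≡ suc z * 5 + w
  lemma = ℕSolver.solve-∀

add5ss≡ : ∀ o m w → add5ss o m w ≡ o * (m * 5) + w
add5ss≡ zero    m w = refl
add5ss≡ (suc o) m w rewrite add5ss≡ o m (add5s m w) | add5s≡ m w = lemma o m w
  where
  lemma : ∀ o m w → o * (m * 5) + (m * 5 + w) ≡ suc o * (m * 5) + w
  lemma = ℕSolver.solve-∀

module _ (m : ℕ) where

  addFives-runs : ∀ z w {o} → ∃ λ t →
    addFives , o ∷ encodeℕ m ∷ encodeℕ z ∷ encodeℕ w ∷ [] ⇓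
      o ∷ encodeℕ m ∷ nil ∷ encodeℕ (add5s z w) ∷ [] within t
  addFives-runs zero    w = _ , while-false refl
  addFives-runs (suc z) w = _ , while-true (λ ()) (seq assign assign) (proj₂ (addFives-runs z (5 + w)))

  multiply-runs : ∀ o w → ∃ λ t →
    multiply , encodeℕ o ∷ encodeℕ m ∷ nil ∷ encodeℕ w ∷ [] ⇓
      nil ∷ encodeℕ m ∷ nil ∷ encodeℕ (add5ss o m w) ∷ [] within t
  multiply-runs zero    w = _ , while-false refl
  multiply-runs (suc o) w = _ , while-true (λ ())
    (seq assign (seq (proj₂ (addFives-runs m w)) assign)) (proj₂ (multiply-runs o (add5s m w)))

sizeBound : ℕ → ℕ → ℕ
sizeBound e k = suc (e + k) * (suc (e + k) * 5)

sizeBody-runs : ∀ e k → ∃₂ λ σ s →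
  (sizeBody e , encodeℕ k ∷ nil ∷ nil ∷ nil ∷ [] ⇓ σ within s) × head σ ≡ encodeℕ (sizeBound e k)
sizeBody-runs e k = _ , _ ,
  seq start (seq assign (seq (proj₂ (multiply-runs (suc (e + k)) (suc (e + k)) 0)) assign)) ,
  cong encodeℕ (trans (add5ss≡ (suc (e + k)) (suc (e + k)) 0) (+-identityʳ (sizeBound e k)))
  where
  σ₀ : Store 4
  σ₀ = encodeℕ k ∷ nil ∷ nil ∷ nil ∷ []
  start : v₀ ≔ addition (suc e) (var v₀) , σ₀ ⇓ encodeℕ (suc (e + k)) ∷ nil ∷ nil ∷ nil ∷ []
    within suc (cost (addition (suc e) (var v₀)))
  start = subst (λ x → v₀ ≔ addition (suc e) (var v₀) , σ₀ ⇓ x ∷ nil ∷ nil ∷ nil ∷ []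
      within suc (cost (addition (suc e) (var v₀))))
    (eval-addition (suc e) k (var v₀) σ₀ refl) assign

sizeBound-computable : ∀ e → Computable encodeℕ encodeℕ (sizeBound e)
sizeBound-computable e = program (sizeBody e) , λ k →
  let σ , s , run , eq = sizeBody-runs e k
  in s + size (encodeℕ (sizeBound e k)) , σ , s , run , eq , refl

-- The numbers are suc k ∸ |S| and e ∸ |V ∖ S|.  The first is 0 iff |S| > k, when
-- every solution has value -∞; the second is positive iff the clique is so small
-- that the instance can be kept.
reduceBy : (G : Graph) (S : Subset (Graph.order G)) (e : ℕ) → ℕ → ℕ → Instance × ℕ
reduceBy G S e zero    _       = (emptyGraph , []) , 0
-- The order is at least |S|, so the new parameter passes the same test as `k` and no value changes.
reduceBy G S e (suc _) (suc _) = (G , S) , Graph.order G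
reduceBy G S e (suc _) zero    = (shrunk , shrunkS) , length L
  where open Shrink G S e

reducedOrder : (G : Graph) (S : Subset (Graph.order G)) (e : ℕ) → ℕ → ℕ → ℕ
reducedOrder G S e k c = Graph.order (proj₁ (proj₁ (reduceBy G S e k c)))

liftBy : (G : Graph) (S : Subset (Graph.order G)) (e : ℕ) → ∀ k c →
  Solution (proj₁ (reduceBy G S e k c)) → Subset (Graph.order G)
-- All solutions have value -∞ here, so any set is optimal; `S` can be copied from the input.
liftBy G S e zero    _       _  = S
liftBy G S e (suc _) (suc _) T′ = T′
liftBy G S e (suc _) zero    T′ = extended T′
  where open Shrink G S e

-- Kernel size and running time for a fixed clique size

module Kernel (G : Graph) (S : Subset (Graph.order G)) (e : ℕ) where
  open Graph G renaming (order to n)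
  open Shrink G S e
  open Runtime G S e

  ∸≡suc⇒< : ∀ {m n j} → m ∸ n ≡ suc j → n < m
  ∸≡suc⇒< {m} {n} eq = ≰⇒> λ m≤n → 0≢1+n (trans (sym (m≤n⇒m∸n≡0 m≤n)) eq)

  ∣S∣≡#S : ∣ S ∣ ≡ #S
  ∣S∣≡#S = ∣∣≡#lookup S

  n≡#S+#C : n ≡ #S + #C
  n≡#S+#C = trans (sym (length-allFin n)) (length≡#+# inS (allFin n))

  parameter≡order : ∀ k c → proj₂ (reduceBy G S e k c) ≡ reducedOrder G S e k c
  parameter≡order zero    _       = refl
  parameter≡order (suc _) (suc _) = refl
  parameter≡order (suc _) zero    = refl

  -- Bounds the output by the input, which the running time needs; `order≤k+e` bounds it by the
  -- parameter, for the kernel size.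
  order≤n : ∀ k c → e ∸ #C ≡ c → reducedOrder G S e k c ≤ n
  order≤n zero    c       eq = z≤n
  order≤n (suc _) (suc c) eq = ≤-refl
  order≤n (suc _) zero    eq = subst₂ _≤_ (sym (order≡ e≤)) (sym n≡#S+#C) (+-monoʳ-≤ #S e≤)
    where e≤ = m∸n≡0⇒m≤n eq

  order≤k+e : ∀ {k} k′ c → suc k ∸ #S ≡ k′ → e ∸ #C ≡ c → reducedOrder G S e k′ c ≤ k + e
  order≤k+e     zero     c       eq eq′ = z≤n
  order≤k+e {k} (suc k′) (suc c) eq eq′ = subst (_≤ k + e) (sym n≡#S+#C)
    (+-mono-≤ (s≤s⁻¹ (∸≡suc⇒< {suc k} {#S} eq)) (<⇒≤ (∸≡suc⇒< {e} {#C} eq′)))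
  order≤k+e {k} (suc k′) zero    eq eq′ = subst (_≤ k + e) (sym (order≡ (m∸n≡0⇒m≤n eq′)))
    (+-monoˡ-≤ e (s≤s⁻¹ (∸≡suc⇒< {suc k} {#S} eq)))

  clock≢nil : ∀ c → clock (suc c) ≢ nil
  clock≢nil zero    ()
  clock≢nil (suc c) ()

  shrunkCode≡ : shrunkCode ≡ encode (shrunk , shrunkS) (length L)
  shrunkCode≡ = cong (_∙ encodeℕ (length L)) (cong₂ _∙_ (sym graph) (sym subset))
    where
    graph : encodeGraph shrunk ≡ encodeList joinedRow L
    graph = trans (encodeGraph≡ shrunk) (trans
      (encodeList-cong (λ i → encodeList-lookup (encodeBool ∘ joined (nth i)) L) (allFin (length L)))
      (encodeList-lookup joinedRow L))
    subset : encodeSubset shrunkS ≡ encodeList (encodeBool ∘ inS ∘ proj₁) L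
    subset = trans (encodeSubset≡ shrunkS) (trans
      (encodeList-cong (cong encodeBool ∘ lookup∘tabulate (inS ∘ proj₁ ∘ nth)) (allFin (length L)))
      (encodeList-lookup (encodeBool ∘ inS ∘ proj₁) L))

  instanceCode : 𝔻
  instanceCode = rowsCode (allFin n) ∙ maskCode (allFin n)

  instanceCode≡ : instanceCode ≡ encodeInstance (G , S)
  instanceCode≡ = cong₂ _∙_ (sym (encodeGraph≡ G)) (sym (encodeSubset≡ S))

  decide-reduce : ∀ k c {kk} → ∃ λ σ →
    (cond (var vParam)
      (cond (var vClock) (vIn ≔ cons (hd (var vIn)) (var vCount)) build)
      (vIn ≔ quot emptyCode) , scanned-store (instanceCode ∙ kk) k c nil ⇓ σ ≤ 9 + buildTime) ×
    head σ ≡ uncurry encode (reduceBy G S e k c)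
  decide-reduce zero    c       =
    _ , weaken (m≤m+n 4 (5 + buildTime)) (if-false≤ refl (exactly assign)) , refl
  decide-reduce (suc k) (suc c) =
    _ , weaken (m≤m+n 9 buildTime) (if-true≤ (λ ()) (if-true≤ (clock≢nil c) (exactly assign))) ,
    cong₂ _∙_ instanceCode≡ (cong encodeℕ (length-allFin n))
  decide-reduce (suc k) zero    with σ , run , eq ← build-run =
    σ , weaken (m≤n+m (4 + buildTime) 5) (if-true≤ (λ ()) (if-false≤ refl run)) ,
    trans eq shrunkCode≡

  decide-lift : ∀ k c (T′ : Solution (proj₁ (reduceBy G S e k c))) {kk} → ∃ λ σ →
    (cond (var vParam)
      (cond (var vClock) (vIn ≔ var vSol) merge)
      (vIn ≔ tl (hd (var vIn))) ,
      scanned-store (instanceCode ∙ kk) k c (encodeSubset T′) ⇓ σ ≤ 9 + mergeTime) ×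
    head σ ≡ encodeSubset (liftBy G S e k c T′)
  decide-lift zero    c       T′ =
    _ , weaken (m≤m+n 6 (3 + mergeTime)) (if-false≤ refl (exactly assign)) , sym (encodeSubset≡ S)
  decide-lift (suc k) (suc c) T′ =
    _ , weaken (m≤m+n 6 (3 + mergeTime)) (if-true≤ (λ ()) (if-true≤ (clock≢nil c) (exactly assign))) , refl
  decide-lift (suc k) zero    T′ {kk} = σ ,
    weaken (m≤n+m (4 + mergeTime) 5) (if-true≤ (λ ()) (if-false≤ refl
      (subst (λ t → merge , (instanceCode ∙ kk) ∷ nil ∷ nil ∷ encodeℕ (suc k) ∷ nil ∷ encodeℕ n′ ∷
          encodeList code scanned ∷ nil ∷ nil ∷ nil ∷ nil ∷ nil ∷ t ∷ [] ⇓ σ ≤ mergeTime)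
        (sym solution) (proj₁ (proj₂ merged))))) ,
    proj₂ (proj₂ merged)
    where
    merged = merge-run T′ {instanceCode ∙ kk} {encodeℕ (suc k)} {nil} {encodeℕ n′}
    σ = proj₁ merged
    solution : encodeSubset T′ ≡ encodeList (encodeBool ∘ restored T′ ∘ proj₁) L
    solution = trans (encodeSubset≡ T′) (trans
      (encodeList-cong (λ i → cong encodeBool (sym (restored-nth T′ i))) (allFin (length L)))
      (encodeList-lookup (encodeBool ∘ restored T′ ∘ proj₁) L))

  Z : ℕ
  Z = size (encodeInstance (G , S))

  1≤Z : 1 ≤ Z
  1≤Z = s≤s z≤n

  open Polynomial 1≤Z

  n<Z : n < Z
  n<Z = order≤size G S

  n′≤Z : n′ ≤ Z
  n′≤Z = subst (_≤ Z) (sym (length-allFin n)) (<⇒≤ n<Z)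

  ℓ≤Z : ℓ ≤ Z
  ℓ≤Z = subst (_≤ Z) (trans (cong length (sym (map-proj₁-mark e (allFin n)))) (length-map proj₁ marked)) n′≤Z

  scanned≤Z : length scanned ≤ Z
  scanned≤Z = subst (_≤ Z) (sym (length-reverse marked)) ℓ≤Z

  -- The coefficient is the sum of the numerals in the time expression and the degree is the nesting
  -- depth of its loops. The other coefficients arise in the same way.
  scanTime≤ : Bounded 2 56 scanTime
  scanTime≤ = const≤ 2 ⊕ n′≤Z ⊗ (const≤ 2 ⊕ const≤ 3 ⊕ const≤ 4 ⊕ (const≤ 2 ⊕ n′≤Z ⊗ const≤ 16) ⊕
    const≤ 15 ⊕ const≤ 2 ⊕ const≤ 4 ⊕ const≤ 3 ⊕ const≤ 3)

  buildTime≤ : Bounded 2 97 buildTime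
  buildTime≤ = (const≤ 2 ⊕ scanned≤Z ⊗ (const≤ 2 ⊕ const≤ 5 ⊕ const≤ 3)) ⊕ const≤ 2 ⊕ const≤ 4 ⊕ const≤ 2 ⊕
    (const≤ 2 ⊕ ℓ≤Z ⊗ (const≤ 2 ⊕ (const≤ 5 ⊕ const≤ 3 ⊕ const≤ 2 ⊕ (const≤ 2 ⊕ ℓ≤Z ⊗ (const≤ 2 ⊕ const≤ 31)) ⊕
      const≤ 4 ⊕ const≤ 2 ⊕ const≤ 6 ⊕ const≤ 4) ⊕ const≤ 3 ⊕ const≤ 3)) ⊕ const≤ 6

  mergeTime≤ : Bounded 2 29 mergeTime
  mergeTime≤ = (const≤ 2 ⊕ scanned≤Z ⊗ (const≤ 2 ⊕ const≤ 23)) ⊕ const≤ 2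

  module _ (k : ℕ) where

    kLeft cLeft : ℕ
    kLeft = suc k ∸ #S
    cLeft = e ∸ #C

    reduction : Instance × ℕ
    reduction = reduceBy G S e kLeft cLeft

    N : ℕ
    N = reducedOrder G S e kLeft cLeft

    N<Z : N < Z
    N<Z = ≤-trans (s≤s (order≤n kLeft cLeft refl)) n<Z

    output : 𝔻
    output = uncurry encode reduction

    size-output≤ : size output ≤ suc N * (suc N * 5)
    size-output≤ = subst (λ p → size (encode (proj₁ reduction) p) ≤ suc N * (suc N * 5))
      (sym (parameter≡order kLeft cLeft))
      (size-encode (proj₁ (proj₁ reduction)) (proj₂ (proj₁ reduction)))

    output≤ : Bounded 2 5 (size output)
    output≤ = size-output≤ ∙≤ (N<Z ⊗ N<Z ⊗ const≤ 5)

    outputSize≤ : size output ≤ sizeBound e k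
    outputSize≤ = ≤-trans size-output≤ (*-mono-≤ N≤ (*-monoˡ-≤ 5 N≤))
      where
      N≤ : suc N ≤ suc (e + k)
      N≤ = s≤s (subst (N ≤_) (+-comm k e) (order≤k+e kLeft cLeft refl refl))

    reduceSteps : ∃ λ σ → (reduceBody e , (instanceCode ∙ encodeℕ k) ∷ replicate 12 nil ⇓ σ
      ≤ 4 + (4 + (5 + (2 + (scanTime + (9 + buildTime)))))) × head σ ≡ output
    reduceSteps = proj₁ decided , scan-run k nil (proj₁ (proj₂ decided)) , proj₂ (proj₂ decided)
      where decided = decide-reduce kLeft cLeft {encodeℕ k}

    liftSteps : ∀ T′ → ∃ λ σ →
      (liftBody e , ((instanceCode ∙ encodeℕ k) ∙ output ∙ encodeSubset T′) ∷ replicate 12 nil ⇓ σ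
      ≤ 4 + (3 + (4 + (4 + (5 + (2 + (scanTime + (9 + mergeTime)))))))) ×
      head σ ≡ encodeSubset (liftBy G S e kLeft cLeft T′)
    liftSteps T′ = proj₁ decided ,
      (exactly assign then exactly assign then scan-run k (encodeSubset T′) (proj₁ (proj₂ decided))) ,
      proj₂ (proj₂ decided)
      where decided = decide-lift kLeft cLeft T′ {encodeℕ k}

    runs-within : ∀ {p : Cmd 13} {input out b c} →
      (∃ λ σ → (p , input ∷ replicate 12 nil ⇓ σ ≤ b) × head σ ≡ out) →
      size out ≤ c → ∃ λ t → Runs (program p) input out t × t ≤ b + c
    runs-within {out = out} (σ , (s , run , s≤) , eq) out≤ =
      s + size out , (σ , s , run , eq , refl) , +-mono-≤ s≤ out≤

    reduceBound : Bounded 2 182 (4 + (4 + (5 + (2 + (scanTime + (9 + buildTime))))) + size output)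
    reduceBound =
      (const≤ 4 ⊕ const≤ 4 ⊕ const≤ 5 ⊕ const≤ 2 ⊕ scanTime≤ ⊕ const≤ 9 ⊕ buildTime≤) ⊕ output≤

    liftBound : Bounded 2 121
      (4 + (3 + (4 + (4 + (5 + (2 + (scanTime + (9 + mergeTime))))))) + suc (n * 4))
    liftBound =
      (const≤ 4 ⊕ const≤ 3 ⊕ const≤ 4 ⊕ const≤ 4 ⊕ const≤ 5 ⊕ const≤ 2 ⊕ scanTime≤ ⊕ const≤ 9 ⊕ mergeTime≤)
      ⊕ const≤ 1 ⊕ <⇒≤ n<Z ⊗ const≤ 4

    reduce-spec : ∃ λ t → Runs (program (reduceBody e)) (encode (G , S) k) output t × t ≤ 182 * Z ^ 2
    reduce-spec = proj₁ result ,
      subst (λ d → Runs (program (reduceBody e)) (d ∙ encodeℕ k) output (proj₁ result)) instanceCode≡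
        (proj₁ (proj₂ result)) ,
      ≤-trans (proj₂ (proj₂ result)) (bound⁻ reduceBound)
      where result = runs-within reduceSteps ≤-refl

    lift-spec : ∀ T′ → ∃ λ t →
      Runs (program (liftBody e)) (encode (G , S) k ∙ output ∙ encodeSubset T′)
        (encodeSubset (liftBy G S e kLeft cLeft T′)) t × t ≤ 182 * Z ^ 2
    lift-spec T′ = proj₁ result ,
      subst (λ d → Runs (program (liftBody e)) ((d ∙ encodeℕ k) ∙ output ∙ encodeSubset T′)
          (encodeSubset (liftBy G S e kLeft cLeft T′)) (proj₁ result)) instanceCode≡
        (proj₁ (proj₂ result)) ,
      ≤-trans (proj₂ (proj₂ result)) (≤-trans (bound⁻ liftBound) (*-monoˡ-≤ (Z ^ 2) (m≤m+n 121 61)))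
      where result = runs-within (liftSteps T′) (size-encodeSubset (liftBy G S e kLeft cLeft T′))

size-∙ˡ : ∀ d d′ → size d ≤ size (d ∙ d′)
size-∙ˡ d d′ = m≤n⇒m≤1+n (m≤m+n (size d) (size d′))

-- The approximate kernel for a given ratio, and the scheme

module KernelAt (α : ℚ) (1<α : 1ℚ ℚ.< α) where
  open Ratio α 1<α

  reductionAt : Instance → ℕ → Instance × ℕ
  reductionAt (G , S) k = Kernel.reduction G S cliqueSize k

  -- Both differences are generalised to variables with equations, so that matching on them lets
  -- `reduceBy` and with it the type of `T′` compute.
  lift-approxBy : ∀ {c} → 1ℚ ℚ.≤ c → ∀ G S k kLeft cLeft →
    suc k ∸ Shrink.#S G S cliqueSize ≡ kLeft →
    cliqueSize ∸ Shrink.#C G S cliqueSize ≡ cLeft →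
    ∀ T′ → let R = reduceBy G S cliqueSize kLeft cLeft in
    IsApprox CVC c (proj₁ R) (proj₂ R) T′ →
    IsApprox CVC (α ℚ.* c) (G , S) k (liftBy G S cliqueSize kLeft cLeft T′)
  lift-approxBy 1≤c G S k zero cLeft eq _ T′ _ =
    Value.approx-⊥ G S (Value.value-many G S (subst (k <_) (sym ∣S∣≡#S) (m∸n≡0⇒m≤n eq)))
    where open Kernel G S cliqueSize
  lift-approxBy 1≤c G S k (suc kLeft) (suc cLeft) eq _ T′ approx =
    Approx.small α 1<α G S 1≤c few (∣p∣≤n S) approx
    where
    open Kernel G S cliqueSize
    few : ∣ S ∣ ≤ k
    few = subst (_≤ k) (sym ∣S∣≡#S) (s≤s⁻¹ (∸≡suc⇒< {suc k} eq))
  lift-approxBy 1≤c G S k (suc kLeft) zero eq eq′ T′ approx =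
    Approx.large α 1<α G S 1≤c few (m∸n≡0⇒m≤n eq′) approx
    where
    open Kernel G S cliqueSize
    few : ∣ S ∣ ≤ k
    few = subst (_≤ k) (sym ∣S∣≡#S) (s≤s⁻¹ (∸≡suc⇒< {suc k} eq))

  kernel : ApproxKernel CVC α
  kernel = record
    { reduceProgram        = program (reduceBody cliqueSize)
    ; reduced              = reductionAt
    ; reduceTime           = λ (G , S) k → proj₁ (Kernel.reduce-spec G S cliqueSize k)
    ; reduce-runs          = λ (G , S) k → proj₁ (proj₂ (Kernel.reduce-spec G S cliqueSize k))
    ; liftProgram          = program (liftBody cliqueSize)
    ; lifted               = λ (G , S) k → liftBy G S cliqueSize (Kernel.kLeft G S cliqueSize k) (Kernel.cLeft G S cliqueSize k)
    ; liftTime             = λ (G , S) k T′ → proj₁ (Kernel.lift-spec G S cliqueSize k T′)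
    ; lift-runs            = λ (G , S) k T′ → proj₁ (proj₂ (Kernel.lift-spec G S cliqueSize k T′))
    ; reduce-polynomial    = 182 , 2 , λ (G , S) k → ≤-trans
        (proj₂ (proj₂ (Kernel.reduce-spec G S cliqueSize k)))
        (enlarge (encodeInstance (G , S)) (encode (G , S) k) (size-∙ˡ (encodeInstance (G , S)) (encodeℕ k)))
    ; lift-polynomial      = 182 , 2 , λ (G , S) k T′ → ≤-trans
        (proj₂ (proj₂ (Kernel.lift-spec G S cliqueSize k T′)))
        (enlarge (encodeInstance (G , S))
          (encode (G , S) k ∙ uncurry encode (reductionAt (G , S) k) ∙ encodeSubset T′)
          (≤-trans (size-∙ˡ (encodeInstance (G , S)) (encodeℕ k))
            (size-∙ˡ (encode (G , S) k) (uncurry encode (reductionAt (G , S) k) ∙ encodeSubset T′))))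
    ; sizeBound            = sizeBound cliqueSize
    ; sizeBound-computable = sizeBound-computable cliqueSize
    ; outputSize-bounded   = λ (G , S) k → Kernel.outputSize≤ G S cliqueSize k
    ; lift-approx          = λ c 1≤c (G , S) k T′ → lift-approxBy 1≤c G S k
        (Kernel.kLeft G S cliqueSize k) (Kernel.cLeft G S cliqueSize k) refl refl T′
    }
    where
    enlarge : ∀ d d′ → size d ≤ size d′ → 182 * size d ^ 2 ≤ 182 * size d′ ^ 2
    enlarge d d′ s≤t = *-monoʳ-≤ 182 (^-monoˡ-≤ 2 s≤t)

  order-bound : ∀ I k → ℤ.+ outputOrder kernel I k ℤ.≤
    ℤ.+ k ℤ.+ ceiling (((ℤ.+ 2 / 1) ℚ.* α ℚ.- 1ℚ) ÷ β)
  order-bound (G , S) k = subst (λ z → ℤ.+ outputOrder kernel (G , S) k ℤ.≤ ℤ.+ k ℤ.+ z)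
    (sym (proj₁ (proj₂ (proj₂ cliqueSize-spec))))
    (ℤ.+≤+ (Kernel.order≤k+e G S cliqueSize
      (Kernel.kLeft G S cliqueSize k) (Kernel.cLeft G S cliqueSize k) refl refl))

  -- Comes from e + 1 + k ≤ (e + 2) max(k, 1), squared, times the factor 5 of the encoding size.
  sizeFactor : ℕ
  sizeFactor = 5 * (2 + cliqueSize) ^ 2

  outputSize-polynomial : ∀ k → sizeBound cliqueSize k ≤ sizeFactor * (k ⊔ 1) ^ 2
  outputSize-polynomial k = ≤-trans (*-mono-≤ lemma (*-monoˡ-≤ 5 lemma))
    (≤-reflexive (regroup (2 + cliqueSize) (k ⊔ 1)))
    where
    lemma : suc (cliqueSize + k) ≤ (2 + cliqueSize) * (k ⊔ 1)
    lemma = subst (_≤ (2 + cliqueSize) * (k ⊔ 1)) (cong suc (+-comm k cliqueSize))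
      (subst (_≤ (2 + cliqueSize) * (k ⊔ 1)) (+-suc k cliqueSize) (+-mono-≤ (m≤m⊔n k 1)
        (subst (_≤ suc cliqueSize * (k ⊔ 1)) (*-identityʳ (suc cliqueSize))
          (*-monoʳ-≤ (suc cliqueSize) (m≤n⊔m k 1)))))
    regroup : ∀ a b → a * b * (a * b * 5) ≡ 5 * (a * (a * 1)) * (b * (b * 1))
    regroup = ℕSolver.solve-∀

-- The scheme asks for a function on all rationals; 0 is the default for α ≤ 1. The proof of 1 < α
-- found by the test agrees with the given one by irrelevance.
sizeFactor : ℚ → ℕ
sizeFactor α with 1ℚ ℚₚ.<? α
... | yes 1<α = KernelAt.sizeFactor α 1<α
... | no  _   = 0

sizeFactor≡ : ∀ α (1<α : 1ℚ ℚ.< α) → sizeFactor α ≡ KernelAt.sizeFactor α 1<α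
sizeFactor≡ α 1<α with 1ℚ ℚₚ.<? α
... | yes 1<α′ = cong (KernelAt.sizeFactor α) (ℚₚ.<-irrelevant 1<α′ 1<α)
... | no  1≮α  = contradiction 1<α 1≮α

psaks : PSAKS CVC
psaks = record
  { kernel                = KernelAt.kernel
  ; f                     = sizeFactor
  ; g                     = λ _ → 2
  ; outputSize-polynomial = λ α 1<α (G , S) k →
      subst (λ f → ApproxKernel.outputSize (KernelAt.kernel α 1<α) (G , S) k ≤ f * (k ⊔ 1) ^ 2)
        (sym (sizeFactor≡ α 1<α))
        (≤-trans (ApproxKernel.outputSize-bounded (KernelAt.kernel α 1<α) (G , S) k)
          (KernelAt.outputSize-polynomial α 1<α k))
  }

-- The time factor is the same for all α: the programs for different α differ only in a quoted
-- constant, and the order of the output never exceeds that of the input.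
timeEfficient : IsTimeEfficient psaks
timeEfficient = (λ _ → 182) , constant-computable , 2 , λ α 1<α (G , S) k →
  proj₂ (proj₂ (Kernel.reduce-spec G S (Ratio.cliqueSize α 1<α) k)) ,
  λ T′ → proj₂ (proj₂ (Kernel.lift-spec G S (Ratio.cliqueSize α 1<α) k T′))
  where
  constant-computable : Computable encodeℚ encodeℕ (λ _ → 182)
  constant-computable = program {0} (zero ≔ quot (encodeℕ 182)) ,
    λ α → _ , _ , _ , assign , refl , refl

theorem9 :
    Σ (PSAKS CVC) λ P →
    IsTimeEfficient P ×
    (∀ α (1<α : 1ℚ ℚ.< α) I k →
      ℤ.+ outputOrder (PSAKS.kernel P α 1<α) I k
        ℤ.≤ ℤ.+ k ℤ.+ ceiling (_÷_ ((ℤ.+ 2 / 1) ℚ.* α ℚ.- 1ℚ) (α ℚ.- 1ℚ) {{1<α⇒α-1≢0 1<α}}))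
theorem9 = psaks , timeEfficient , KernelAt.order-bound
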